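{- Let $(X,\mathcal A,\mu)$ be a normalized finitely additive measure space. Suppose that for every $P\in\mathcal A$ which occurs as a part of a partition of $X$, a non-empty family $\mathcal F_P$ of measurable functions $f:P\to\mathbb C$ with $\|f\|_\infty\le 1$ is fixed. Suppose that for every positive integer $M$ a class $\mathsf{Part}_M(X)$ of (admissible) partitions of $X$ with at most $M$ parts is fixed. Suppose further that a refinement scheme $(\Phi,\psi)$ is given for which the chosen witnesses become measurable with respect to the refinement; that is, $\Phi:\mathbb N\to\mathbb N$ is a function and $\psi$ assigns to every partition $\mathcal P\in\mathsf{Part}_M(X)$ ($M$ a positive integer) and every family of witnesses $\{f_P\}_{P\in\mathcal P}$ with $f_P\in\mathcal F_P$ for each $P\in\mathcal P$ a partition $\mathcal P'=\psi(\mathcal P,\{f_P\}_{P\in\mathcal P})\in\mathsf{Part}_{\Phi(M)}(X)$ which refines $\mathcal P$ and is such that, for each $P\in\mathcal P$, the function $f_P$ is constant on every part of $\mathcal P'|_P$. Let $g:X\to[0,1]$ be an $\mathcal A$-measurable function, let $\varepsilon>0$, let $M_0$ be a positive integer, and let $\mathcal P_0\in\mathsf{Part}_{M_0}(X)$. Then there exist an integer $t$ with $0\le t\le\lceil\varepsilon^{ -2}\rceil$ and a partition $\mathcal P_t\in\mathsf{Part}_{\Phi^{\circ t}(M_0)}(X)$ which is $\varepsilon$-regular for $g$ with respect to the families $(\mathcal F_P)_{P\in\mathcal P_t}$, where $\Phi^{\circ t}$ denotes the $t$-fold composition of $\Phi$ with itself.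
   Context: A normalized finitely additive measure space $(X,\mathcal A,\mu)$ consists of a set $X$, an algebra $\mathcal A$ of subsets of $X$ (not necessarily a $\sigma$-algebra), and a finitely additive function $\mu:\mathcal A\to[0,1]$ with $\mu(X)=1$. Integrals of bounded $\mathcal A$-measurable functions with respect to $\mu$ are the usual ones for finitely additive measures (defined on simple functions and extended by uniform limits). For $P\in\mathcal A$ with $\mu(P)>0$ and a bounded measurable function $h$ (on $X$ or on $P$), $\mathbb E_P[h]=\frac1{\mu(P)}\int_P h\,d\mu$. A partition of $X$ always means a finite collection $\{P_1,\dots,P_n\}\subset\mathcal A$ of disjoint sets with $\bigcup_i P_i=X$ and $\mu(P_i)>0$ for all $i$. A partition $\mathcal Q$ refines a partition $\mathcal P$ if every $Q\in\mathcal Q$ is contained in some $P\in\mathcal P$. For $P\in\mathcal P$, $\mathcal Q|_P=\{Q\in\mathcal Q: Q\subseteq P\}$. Regularity: given an $\mathcal A$-measurable $g:X\to[0,1]$, a partition $\mathcal P$ is $\varepsilon$-regular for $g$ with respect to the families $(\mathcal F_P)_{P\in\mathcal P}$ if $$\sum_{P\in\mathcal P}\mu(P)\sup_{f\in\mathcal F_P}\left|\mathbb E_P\left[(g|_P-\mathbb E_P[g|_P])\cdot f\right]\right|\le\varepsilon,$$ where $g|_P$ is the restriction of $g$ to $P$. Here $\Phi^{\circ 0}$ is the identity. -}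

module Defs where

open import Algebra.Bundles using (CommutativeRing; RawRing)
import Algebra.Definitions.RawMonoid as RawMonoidDefinitions
import Algebra.Properties.Ring as RingProperties
open import Data.Fin.Base using (Fin)
open import Data.Nat.Base as ℕ using (ℕ; NonZero)
open import Data.Product.Base using (Σ; ∃; ∃-syntax; _×_; _,_; proj₁)
open import Data.Sum.Base using (inj₁; inj₂)
open import Function.Bundles using (Func)
open import Level using (Level; suc; _⊔_)
open import Relation.Binary.Bundles using (Setoid)
open import Relation.Binary.Core using (Rel)
import Relation.Binary.Construct.NonStrictToStrict as NonStrictToStrict
import Relation.Binary.Construct.On as On
open import Relation.Binary.PropositionalEquality as ≡ using (_≢_)
open import Relation.Binary.Structures using (IsTotalOrder)
open import Relation.Nullary.Negation using (¬_)
open import Relation.Unary using (Pred; _∈_; _⊆_; _≐_; _∪_; ∁; Satisfiable; _⊥_)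
open import Relation.Unary.Polymorphic using (U)

-- The standard library has no real numbers.  They are specified here by the
-- axioms of a Dedekind-complete ordered field, which classically determine
-- them up to isomorphism.

record CompleteOrderedField (ℓ : Level) : Set (suc ℓ) where
  infix  4 _≤_
  infix  9 _⁻¹

  field
    commutativeRing : CommutativeRing ℓ ℓ

  open CommutativeRing commutativeRing public

  field
    _≤_          : Rel Carrier ℓ
    isTotalOrder : IsTotalOrder _≈_ _≤_
    +-monoʳ-≤    : ∀ z {x y} → x ≤ y → z + x ≤ z + y
    *-nonneg     : ∀ {x y} → 0# ≤ x → 0# ≤ y → 0# ≤ x * y

    -- The value of the inverse at 0# is unconstrained.
    _⁻¹          : Carrier → Carrier
    ⁻¹-inverseʳ  : ∀ {x} → ¬ x ≈ 0# → x * x ⁻¹ ≈ 1#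
    0≉1          : ¬ 0# ≈ 1#

  IsUpperBound : Pred Carrier ℓ → Pred Carrier ℓ
  IsUpperBound S b = ∀ {x} → x ∈ S → x ≤ b

  IsSupremum : Pred Carrier ℓ → Pred Carrier ℓ
  IsSupremum S s = IsUpperBound S s × (∀ {b} → IsUpperBound S b → s ≤ b)

  field
    complete : ∀ S → Satisfiable S → Satisfiable (IsUpperBound S) →
               Satisfiable (IsSupremum S)

  open NonStrictToStrict _≈_ _≤_ public using (_<_)
  open RawMonoidDefinitions +-rawMonoid public using (sum) renaming (_×_ to _·_)

  fromℕ : ℕ → Carrier
  fromℕ n = n · 1#

  -- For x ≥ 0 the least integer that is ≥ x is a natural number; for negative x
  -- this is 0 and not the usual ceiling.
  IsCeiling : Carrier → Pred ℕ ℓ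
  IsCeiling x n = x ≤ fromℕ n × (∀ {m} → x ≤ fromℕ m → n ℕ.≤ m)

  private
    module ≤ = IsTotalOrder isTotalOrder
    open RingProperties ring

  +-nonneg : ∀ {x y} → 0# ≤ x → 0# ≤ y → 0# ≤ x + y
  +-nonneg {x} 0≤x 0≤y =
    ≤.trans 0≤x (≤.trans (≤.reflexive (sym (+-identityʳ x))) (+-monoʳ-≤ x 0≤y))

  x*x-nonneg : ∀ x → 0# ≤ x * x
  x*x-nonneg x with ≤.total 0# x
  ... | inj₁ 0≤x = *-nonneg 0≤x 0≤x
  ... | inj₂ x≤0 = ≤.trans (*-nonneg 0≤-x 0≤-x) (≤.reflexive -x*-x≈x*x)
    where
    0≤-x : 0# ≤ - x
    0≤-x = ≤.trans (≤.reflexive (sym (-‿inverseˡ x)))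
          (≤.trans (+-monoʳ-≤ (- x) x≤0) (≤.reflexive (+-identityʳ (- x))))

    -x*-x≈x*x : - x * - x ≈ x * x
    -x*-x≈x*x = trans (sym (-‿distribˡ-* x (- x)))
               (trans (-‿cong (sym (-‿distribʳ-* x x))) (-‿involutive (x * x)))

  √ : ∀ x → 0# ≤ x → Carrier
  √ x 0≤x = proj₁ (complete (λ y → y * y ≤ x) (0# , 0*0≤x) (1# + x , bounded))
    where
    0*0≤x : 0# * 0# ≤ x
    0*0≤x = ≤.trans (≤.reflexive (zeroˡ 0#)) 0≤x

    0≤1 : 0# ≤ 1#
    0≤1 = ≤.trans (x*x-nonneg 1#) (≤.reflexive (*-identityˡ 1#))

    x≤1+x : x ≤ 1# + x
    x≤1+x = ≤.trans (≤.reflexive (sym (+-identityʳ x)))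
           (≤.trans (+-monoʳ-≤ x 0≤1) (≤.reflexive (+-comm x 1#)))

    y≤y*y : ∀ {y} → 1# ≤ y → y ≤ y * y
    y≤y*y {y} 1≤y =
      ≤.trans (≤.reflexive (sym (+-identityʳ y)))
     (≤.trans (+-monoʳ-≤ y (*-nonneg (≤.trans 0≤1 1≤y) 0≤y-1))
              (≤.reflexive y+y[y-1]≈y*y))
      where
      0≤y-1 : 0# ≤ - 1# + y
      0≤y-1 = ≤.trans (≤.reflexive (sym (-‿inverseˡ 1#))) (+-monoʳ-≤ (- 1#) 1≤y)

      y+y[y-1]≈y*y : y + y * (- 1# + y) ≈ y * y
      y+y[y-1]≈y*y =
        trans (+-congʳ (sym (*-identityʳ y)))
       (trans (sym (distribˡ y 1# (- 1# + y)))
              (*-congˡ (trans (sym (+-assoc 1# (- 1#) y))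
                       (trans (+-congʳ (-‿inverseʳ 1#)) (+-identityˡ y)))))

    bounded : ∀ {y} → y * y ≤ x → y ≤ 1# + x
    bounded {y} y*y≤x with ≤.total y (1# + x)
    ... | inj₁ y≤1+x = y≤1+x
    ... | inj₂ 1+x≤y = ≤.trans (y≤y*y 1≤y) (≤.trans y*y≤x x≤1+x)
      where
      1≤y : 1# ≤ y
      1≤y = ≤.trans (≤.trans (≤.reflexive (sym (+-identityʳ 1#))) (+-monoʳ-≤ 1# 0≤x))
                    1+x≤y

module Complex {ℓ} (R : CompleteOrderedField ℓ) where
  private module ℝ = CompleteOrderedField R

  record ℂ : Set ℓ where
    constructor _+i_
    field
      re im : ℝ.Carrier

  open ℂ public

  rawRing : RawRing ℓ ℓ
  rawRing = record
    { Carrier = ℂ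
    ; _≈_     = λ z w → re z ℝ.≈ re w × im z ℝ.≈ im w
    ; _+_     = λ z w → (re z ℝ.+ re w) +i (im z ℝ.+ im w)
    ; _*_     = λ z w → (re z ℝ.* re w ℝ.- im z ℝ.* im w) +i
                        (re z ℝ.* im w ℝ.+ im z ℝ.* re w)
    ; -_      = λ z → (ℝ.- re z) +i (ℝ.- im z)
    ; 0#      = ℝ.0# +i ℝ.0#
    ; 1#      = ℝ.1# +i ℝ.0#
    }

  open RawRing rawRing public hiding (Carrier)
  open RawMonoidDefinitions +-rawMonoid public using (sum)

  infixl 6 _-_
  _-_ : ℂ → ℂ → ℂ
  z - w = z + (- w)

  ofReal : ℝ.Carrier → ℂ
  ofReal x = x +i ℝ.0#

  ∣_∣ : ℂ → ℝ.Carrier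
  ∣ z ∣ = ℝ.√ (re z ℝ.* re z ℝ.+ im z ℝ.* im z)
              (ℝ.+-nonneg (ℝ.x*x-nonneg (re z)) (ℝ.x*x-nonneg (im z)))

  setoid : Setoid ℓ ℓ
  setoid = record
    { _≈_           = _≈_
    ; isEquivalence = record
      { refl  = ℝ.refl , ℝ.refl
      ; sym   = λ (p , q) → ℝ.sym p , ℝ.sym q
      ; trans = λ (p , q) (p′ , q′) → ℝ.trans p p′ , ℝ.trans q q′
      }
    }

  *-congˡ : ∀ {z w w′} → w ≈ w′ → z * w ≈ z * w′
  *-congˡ (p , q) =
      ℝ.+-cong (ℝ.*-congˡ p) (ℝ.-‿cong (ℝ.*-congˡ q))
    , ℝ.+-cong (ℝ.*-congˡ q) (ℝ.*-congˡ p)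

record MeasureSpace {ℓ} (R : CompleteOrderedField ℓ) : Set (suc (suc ℓ)) where
  open CompleteOrderedField R

  field
    X : Set ℓ

    -- An algebra of subsets.  Sets are predicates, so that invariance under
    -- extensional equality has to be required.
    𝒜      : Pred (Pred X ℓ) (suc ℓ)
    𝒜-resp : ∀ {A B} → A ≐ B → A ∈ 𝒜 → B ∈ 𝒜
    𝒜-U    : U ∈ 𝒜
    𝒜-∁    : ∀ {A} → A ∈ 𝒜 → ∁ A ∈ 𝒜
    𝒜-∪    : ∀ {A B} → A ∈ 𝒜 → B ∈ 𝒜 → (A ∪ B) ∈ 𝒜

    μ          : ∀ {A} → A ∈ 𝒜 → Carrier
    μ-cong     : ∀ {A B} (a : A ∈ 𝒜) (b : B ∈ 𝒜) → A ≐ B → μ a ≈ μ b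
    0≤μ        : ∀ {A} (a : A ∈ 𝒜) → 0# ≤ μ a
    μ≤1        : ∀ {A} (a : A ∈ 𝒜) → μ a ≤ 1#
    μ-additive : ∀ {A B} (a : A ∈ 𝒜) (b : B ∈ 𝒜) → A ⊥ B →
                 μ (𝒜-∪ a b) ≈ μ a + μ b
    μ-U        : μ 𝒜-U ≈ 1#

module _ {ℓ} {R : CompleteOrderedField ℓ} (S : MeasureSpace R) where
  private
    module ℝ = CompleteOrderedField R
    module ℂ = Complex R
  open ℂ using (ℂ; ofReal; ∣_∣)
  open MeasureSpace S

  -- Functions P → ℂ.  The elements of P are pairs of a point and a proof of
  -- membership; the setoid structure makes the values independent of the proof.
  Fun : Pred X ℓ → Set ℓ
  Fun P = Func (On.setoid {B = Σ X P} (≡.setoid X) proj₁) ℂ.setoid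

  _⟪_⟫ : ∀ {P x} → Fun P → x ∈ P → ℂ
  f ⟪ x∈P ⟫ = Func.to f (_ , x∈P)

  -- The function with constant value `value k` on `piece k`.
  record Simple (P : Pred X ℓ) : Set (suc ℓ) where
    field
      size       : ℕ
      piece      : Fin size → Pred X ℓ
      measurable : ∀ k → piece k ∈ 𝒜
      piece⊆     : ∀ k → piece k ⊆ P
      disjoint   : ∀ {k l} → k ≢ l → piece k ⊥ piece l
      covers     : ∀ {x} → x ∈ P → ∃[ k ] x ∈ piece k
      value      : Fin size → ℂ

    ∫ : ℂ
    ∫ = ℂ.sum λ k → ofReal (μ (measurable k)) ℂ.* value k

    -- The uniform distance from h is at most δ.
    IsNear : Fun P → ℝ.Carrier → Set ℓ
    IsNear h δ = ∀ k {x} (x∈P : x ∈ P) → x ∈ piece k →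
                 ∣ (h ⟪ x∈P ⟫) ℂ.- value k ∣ ℝ.≤ δ

  -- Bounded measurable functions are the uniform limits of simple functions.
  -- Over an algebra that is not a σ-algebra, this class (unlike the functions
  -- with measurable level sets) is closed under sums and products; it contains
  -- every bounded function for which preimages of intervals, or of rectangles,
  -- lie in 𝒜.
  BoundedMeasurable : ∀ {P} → Fun P → Set (suc ℓ)
  BoundedMeasurable {P} h =
    ∀ {δ} → ℝ.0# ℝ.< δ → Σ (Simple P) λ s → Simple.IsNear s h δ

  -- I is the limit of the integrals of simple functions converging uniformly to h.
  IsIntegral : ∀ {P} → Fun P → ℂ → Set (suc ℓ)
  IsIntegral {P} h I =
    ∀ {δ} → ℝ.0# ℝ.< δ →
    Σ (Simple P) λ s → Simple.IsNear s h δ × ∣ Simple.∫ s ℂ.- I ∣ ℝ.≤ δ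

  IsExpectation : ∀ {P} → P ∈ 𝒜 → Fun P → ℂ → Set (suc ℓ)
  IsExpectation P∈𝒜 h e =
    ∃[ I ] IsIntegral h I × e ℂ.≈ ofReal (μ P∈𝒜 ℝ.⁻¹) ℂ.* I

  -- Parts are listed in some order, without repetition by `disjoint` and `positive`.
  record Partition : Set (suc ℓ) where
    field
      size       : ℕ
      part       : Fin size → Pred X ℓ
      measurable : ∀ i → part i ∈ 𝒜
      disjoint   : ∀ {i j} → i ≢ j → part i ⊥ part j
      covers     : ∀ x → ∃[ i ] x ∈ part i
      positive   : ∀ i → ℝ.0# ℝ.< μ (measurable i)

  open Partition

  _Refines_ : Partition → Partition → Set ℓ
  𝒬 Refines 𝒫 = ∀ j → ∃[ i ] part 𝒬 j ⊆ part 𝒫 i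

  restrict : (X → ℝ.Carrier) → ∀ P → Fun P
  restrict g P = record
    { to   = λ (x , _) → ofReal (g x)
    ; cong = λ x≡y → Setoid.reflexive ℂ.setoid (≡.cong (λ x → ofReal (g x)) x≡y)
    }

  -- (g|_P - c) · f
  centred : ∀ {P} → (X → ℝ.Carrier) → ℂ → Fun P → Fun P
  centred g c f = record
    { to   = λ y@(x , _) → (ofReal (g x) ℂ.- c) ℂ.* Func.to f y
    ; cong = λ { {y} {z} ≡.refl → ℂ.*-congˡ (Func.cong f {y} {z} ≡.refl) }
    }

  -- A family is given for every predicate, but conditions are imposed, and the
  -- family is used, only for those that occur as parts of partitions.
  -- Extensionally equal predicates are not required to have equal families.
  Families : Set (suc ℓ)
  Families = (P : Pred X ℓ) → Pred (Fun P) ℓ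

  -- All expectations and suprema in the regularity inequality are required to
  -- exist, so that the inequality is never satisfied for lack of a value.
  record IsRegular (𝓕 : Families) (g : X → ℝ.Carrier) (ε : ℝ.Carrier)
                   (𝒫 : Partition) : Set (suc ℓ) where
    field
      mean             : Fin (size 𝒫) → ℂ
      mean-expectation : ∀ i → IsExpectation (measurable 𝒫 i)
                                 (restrict g (part 𝒫 i)) (mean i)

      correlation             : ∀ i {f} → f ∈ 𝓕 (part 𝒫 i) → ℂ
      correlation-expectation : ∀ i {f} (f∈𝓕 : f ∈ 𝓕 (part 𝒫 i)) →
                                IsExpectation (measurable 𝒫 i)
                                  (centred g (mean i) f) (correlation i f∈𝓕)

      sup            : Fin (size 𝒫) → ℝ.Carrier
      sup-isSupremum : ∀ i → ℝ.IsSupremum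
        (λ v → ∃[ f ] Σ (f ∈ 𝓕 (part 𝒫 i)) λ f∈𝓕 → v ℝ.≈ ∣ correlation i f∈𝓕 ∣)
        (sup i)

      inequality : ℝ.sum (λ i → μ (measurable 𝒫 i) ℝ.* sup i) ℝ.≤ ε

  record IsWitnessFamily (P : Pred X ℓ) (F : Pred (Fun P) ℓ) : Set (suc ℓ) where
    field
      nonempty   : Satisfiable F
      measurable : ∀ {f} → f ∈ F → BoundedMeasurable f
      norm≤1     : ∀ {f} → f ∈ F → ∀ {x} (x∈P : x ∈ P) → ∣ f ⟪ x∈P ⟫ ∣ ℝ.≤ ℝ.1#

  Witnesses : Families → Partition → Set ℓ
  Witnesses 𝓕 𝒫 = ∀ i → Satisfiable (𝓕 (part 𝒫 i))

  -- In `ℕ → Pred Partition p` the class at 0 carries no information: a partition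
  -- has at least one part, so a class of partitions with at most 0 parts is empty.
  Admissible : ∀ {p} → (ℕ → Pred Partition p) → Pred Partition p
  Admissible Part 𝒫 = ∃[ M ] NonZero M × 𝒫 ∈ Part M

  record RefinementScheme {p} (𝓕 : Families) (Part : ℕ → Pred Partition p) :
                          Set (suc ℓ ⊔ p) where
    field
      Φ : ℕ → ℕ
      ψ : ∀ 𝒫 → 𝒫 ∈ Admissible Part → Witnesses 𝓕 𝒫 → Partition

      ψ-Part     : ∀ {𝒫} (adm : 𝒫 ∈ Admissible Part) (w : Witnesses 𝓕 𝒫) →
                   ∀ {M} → NonZero M → 𝒫 ∈ Part M → ψ 𝒫 adm w ∈ Part (Φ M)
      ψ-refines  : ∀ {𝒫} (adm : 𝒫 ∈ Admissible Part) (w : Witnesses 𝓕 𝒫) →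
                   ψ 𝒫 adm w Refines 𝒫
      ψ-constant : ∀ {𝒫} (adm : 𝒫 ∈ Admissible Part) (w : Witnesses 𝓕 𝒫) →
                   ∀ i j (Q⊆P : part (ψ 𝒫 adm w) j ⊆ part 𝒫 i) →
                   ∀ {x y} (x∈Q : x ∈ part (ψ 𝒫 adm w) j)
                           (y∈Q : y ∈ part (ψ 𝒫 adm w) j) →
                   (proj₁ (w i) ⟪ Q⊆P x∈Q ⟫) ℂ.≈ (proj₁ (w i) ⟪ Q⊆P y∈Q ⟫)

{-# OPTIONS --safe #-}
-- Energy increment.  The energy Σ μ(P) E_P[g]² of a partition lies in [0, 1].  If a partition is not
-- ε-regular, witnesses f_P can be chosen with Σ μ(P) |E_P[(g − E_P g) f_P]| ≥ ε, because the suprema are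
-- approximated within the finite surplus of their weighted sum over ε.  On the refinement 𝒬 given by the
-- scheme the witnesses are constant on the parts, so this sum is at most Σ μ(Q) |E_Q g − E_P g| over the
-- parts Q ⊆ P, and the energy grows by Σ μ(Q) (E_Q g − E_P g)² ≥ ε².  Hence ⌈ε⁻²⌉ + 1 successive failures
-- would push the energy above 1.
module Submission where

open import Defs
open import Algebra.Bundles using (CommutativeRing; RawRing)
import Algebra.Properties.AbelianGroup as AbelianGroupProperties
import Algebra.Properties.Ring as RingProperties
import Algebra.Properties.Semiring.Mult.TCOptimised as Multiplication
import Algebra.Properties.Semiring.Sum as SemiringSum
import Algebra.Solver.Ring as RingSolver
open import Algebra.Solver.Ring.AlmostCommutativeRing
  using (fromCommutativeRing; Induced-equivalence; _-Raw-AlmostCommutative⟶_)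
open import Axiom.ExcludedMiddle using (ExcludedMiddle)
open import Data.Fin.Base using (Fin; zero; suc; combine; remQuot)
open import Data.Fin.Properties as Fin using (combine-remQuot; remQuot-combine)
open import Data.Integer.Base as ℤ using (ℤ; +_; -[1+_]; _⊖_; _◃_)
import Data.Integer.Properties as ℤ
open import Data.Maybe.Base using (just; nothing)
open import Data.Nat.Base as ℕ using (ℕ; zero; suc; NonZero)
open import Data.Nat.GeneralisedArithmetic using (fold)
import Data.Nat.Properties as ℕ
open import Data.Product.Base using (Σ; ∃-syntax; _×_; _,_; proj₁; proj₂)
open import Data.Sign.Base as Sign using (Sign)
open import Data.Sum.Base using (_⊎_; inj₁; inj₂)
open import Data.Unit.Polymorphic.Base using (tt)
open import Function.Base using (_∘_)
open import Function.Bundles using (Func)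
open import Level as Level using (Lift; lift; lower)
open import Relation.Binary.Bundles using (Poset; Setoid)
open import Relation.Binary.Definitions using (WeaklyDecidable)
open import Relation.Binary.PropositionalEquality as ≡ using (_≡_; _≢_)
import Relation.Binary.Reasoning.PartialOrder as PosetReasoning
import Relation.Binary.Reasoning.Setoid as SetoidReasoning
open import Relation.Binary.Structures using (IsTotalOrder)
open import Relation.Nullary.Decidable.Core using (Dec; yes; no)
open import Relation.Nullary.Negation using (¬_; contradiction)
open import Relation.Unary using (Pred; _∈_; _∉_; _⊆_; _≐_; _∩_; _∪_; ∁; _⊥_)
open import Relation.Unary.Polymorphic using (U)

-- Sums over the parts Q ⊆ P are written as sums over all pairs (i, j), through the cells P_i ∩ Q_j.
-- Since 𝒬 refines 𝒫, each cell is either the whole of Q_j or empty, so nothing has to be regrouped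
-- by the parent of Q_j, and one matrix of cell measures has the measures of both partitions as its
-- marginals. Without a σ-algebra, integrals are limits of integrals of simple functions, indexed
-- here by the tolerance itself. Their existence has to be proved, because `IsRegular` asks for
-- actual values of all expectations and suprema. An integral is determined only up to `≈`, and the
-- values picked for the same set under two membership proofs may differ, so additivity of the
-- integral is proved for arbitrary integrals of the pieces and also supplies uniqueness. The
-- averages of g come out as complex limits and are replaced by their real parts; the energy is then
-- a real quadratic form, and the increment becomes a ring identity with a nonnegative certificate.

-- Ring identities with integer coefficients.

module IntegerCoefficientSolver {c ℓ} (R : CommutativeRing c ℓ) where
  open CommutativeRing R
  open AbelianGroupProperties +-abelianGroup using (⁻¹-∙-comm; ⁻¹-involutive)
  open RingProperties ring using (-‿distribˡ-*; -‿distribʳ-*; -0#≈0#)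
  open Multiplication semiring using (×-homo-+; ×1-homo-*; 1+×) renaming (_×_ to _·_)
  open SetoidReasoning setoid

  private
    -- Normal forms require a decision of equality between coefficients; it computes on ℤ but not on
    -- an abstract `Carrier`. With this form of multiples, `+ 1` denotes `1#` itself and not
    -- `1# + 0#`.
    ⟦_⟧ : ℤ → Carrier
    ⟦ + n ⟧      = n · 1#
    ⟦ -[1+ n ] ⟧ = - (suc n · 1#)

    cancel : ∀ x y z → (x + y) - (x + z) ≈ y - z
    cancel x y z = begin
      (x + y) - (x + z)       ≈⟨ +-cong (+-comm y x) (⁻¹-∙-comm x z) ⟨
      (y + x) + (- x + - z)   ≈⟨ +-assoc y x _ ⟩
      y + (x + (- x + - z))   ≈⟨ +-congˡ (+-assoc x (- x) (- z)) ⟨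
      y + ((x - x) + - z)     ≈⟨ +-congˡ (+-congʳ (-‿inverseʳ x)) ⟩
      y + (0# + - z)          ≈⟨ +-congˡ (+-identityˡ (- z)) ⟩
      y - z                   ∎

    ⊖-homo : ∀ m n → ⟦ m ⊖ n ⟧ ≈ m · 1# - n · 1#
    ⊖-homo zero    zero    = sym (-‿inverseʳ 0#)
    ⊖-homo zero    (suc n) = sym (+-identityˡ _)
    ⊖-homo (suc m) zero    = sym (trans (+-congˡ -0#≈0#) (+-identityʳ _))
    ⊖-homo (suc m) (suc n) = begin
      ⟦ suc m ⊖ suc n ⟧                ≡⟨ ≡.cong ⟦_⟧ (ℤ.[1+m]⊖[1+n]≡m⊖n m n) ⟩
      ⟦ m ⊖ n ⟧                        ≈⟨ ⊖-homo m n ⟩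
      m · 1# - n · 1#                  ≈⟨ cancel 1# _ _ ⟨
      (1# + m · 1#) - (1# + n · 1#)    ≈⟨ +-cong (1+× m 1#) (-‿cong (1+× n 1#)) ⟨
      suc m · 1# - suc n · 1#          ∎

    +-homo : ∀ i j → ⟦ i ℤ.+ j ⟧ ≈ ⟦ i ⟧ + ⟦ j ⟧
    +-homo (+ m)    (+ n)    = ×-homo-+ 1# m n
    +-homo (+ m)    -[1+ n ] = ⊖-homo m (suc n)
    +-homo -[1+ m ] (+ n)    = trans (⊖-homo n (suc m)) (+-comm _ _)
    +-homo -[1+ m ] -[1+ n ] = begin
      - (suc (suc (m ℕ.+ n)) · 1#)        ≡⟨ ≡.cong (λ k → - (suc k · 1#)) (ℕ.+-suc m n) ⟨
      - ((suc m ℕ.+ suc n) · 1#)          ≈⟨ -‿cong (×-homo-+ 1# (suc m) (suc n)) ⟩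
      - (suc m · 1# + suc n · 1#)         ≈⟨ ⁻¹-∙-comm _ _ ⟨
      - (suc m · 1#) + - (suc n · 1#)     ∎

    +◃-homo : ∀ n → ⟦ Sign.+ ◃ n ⟧ ≈ n · 1#
    +◃-homo zero    = refl
    +◃-homo (suc n) = refl

    -◃-homo : ∀ n → ⟦ Sign.- ◃ n ⟧ ≈ - (n · 1#)
    -◃-homo zero    = sym -0#≈0#
    -◃-homo (suc n) = refl

    *-homo : ∀ i j → ⟦ i ℤ.* j ⟧ ≈ ⟦ i ⟧ * ⟦ j ⟧
    *-homo (+ m)    (+ n)    = trans (+◃-homo (m ℕ.* n)) (×1-homo-* m n)
    *-homo (+ m)    -[1+ n ] =
      trans (-◃-homo (m ℕ.* suc n)) (trans (-‿cong (×1-homo-* m (suc n))) (-‿distribʳ-* _ _))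
    *-homo -[1+ m ] (+ n)    =
      trans (-◃-homo (suc m ℕ.* n)) (trans (-‿cong (×1-homo-* (suc m) n)) (-‿distribˡ-* _ _))
    *-homo -[1+ m ] -[1+ n ] = begin
      (suc m ℕ.* suc n) · 1#                  ≈⟨ ×1-homo-* (suc m) (suc n) ⟩
      (suc m · 1#) * (suc n · 1#)             ≈⟨ ⁻¹-involutive _ ⟨
      - (- ((suc m · 1#) * (suc n · 1#)))     ≈⟨ -‿cong (-‿distribʳ-* _ _) ⟩
      - ((suc m · 1#) * - (suc n · 1#))       ≈⟨ -‿distribˡ-* _ _ ⟩
      - (suc m · 1#) * - (suc n · 1#)         ∎

    -‿homo : ∀ i → ⟦ ℤ.- i ⟧ ≈ - ⟦ i ⟧
    -‿homo (+ zero)  = sym -0#≈0#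
    -‿homo (+ suc n) = refl
    -‿homo -[1+ n ]  = sym (⁻¹-involutive _)

    morphism : ℤ.+-*-rawRing -Raw-AlmostCommutative⟶ fromCommutativeRing R
    morphism = record
      { ⟦_⟧    = ⟦_⟧
      ; +-homo = +-homo
      ; *-homo = *-homo
      ; -‿homo = -‿homo
      ; 0-homo = refl
      ; 1-homo = refl
      }

    _coeff≟_ : WeaklyDecidable (Induced-equivalence morphism)
    i coeff≟ j with i ℤ.≟ j
    ... | yes ≡.refl = just refl
    ... | no _       = nothing

  open RingSolver ℤ.+-*-rawRing (fromCommutativeRing R) morphism _coeff≟_ public
    using (solve; con; _:=_; _:+_; _:*_; _:-_; :-_)

-- Order, square roots, limits and ceilings in a complete ordered field.

module RealProperties {ℓ} (em : ExcludedMiddle ℓ) (R : CompleteOrderedField ℓ) where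
  open CompleteOrderedField R hiding (sum; zero)
  open IntegerCoefficientSolver commutativeRing public
  open SemiringSum semiring public
    using (sum; sum-cong-≋; ∑-distrib-+; ∑-comm; *-distribˡ-sum; *-distribʳ-sum)
  module ≤ = IsTotalOrder isTotalOrder

  poset : Poset ℓ ℓ ℓ
  poset = record { isPartialOrder = ≤.isPartialOrder }

  open PosetReasoning poset

  x≤y⇒0≤y-x : ∀ {x y} → x ≤ y → 0# ≤ y - x
  x≤y⇒0≤y-x {x} {y} x≤y = begin
    0#        ≈⟨ -‿inverseˡ x ⟨
    - x + x   ≤⟨ +-monoʳ-≤ (- x) x≤y ⟩
    - x + y   ≈⟨ +-comm (- x) y ⟩
    y - x     ∎

  -- Reduces an inequality to the nonnegativity of a certificate e and a ring identity.
  ≤-from : ∀ {x y e} → 0# ≤ e → e ≈ y - x → x ≤ y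
  ≤-from {x} {y} {e} 0≤e e≈y-x = begin
    x             ≈⟨ +-identityʳ x ⟨
    x + 0#        ≤⟨ +-monoʳ-≤ x 0≤e ⟩
    x + e         ≈⟨ +-congˡ e≈y-x ⟩
    x + (y - x)   ≈⟨ solve 2 (λ x y → x :+ (y :- x) := y) refl x y ⟩
    y             ∎

  +-mono-≤ : ∀ {x y u v} → x ≤ y → u ≤ v → x + u ≤ y + v
  +-mono-≤ {x} {y} {u} {v} p q = ≤-from (+-nonneg (x≤y⇒0≤y-x p) (x≤y⇒0≤y-x q))
    (solve 4 (λ x y u v → (y :- x) :+ (v :- u) := (y :+ v) :- (x :+ u)) refl x y u v)

  *-monoˡ-≤ : ∀ {z x y} → 0# ≤ z → x ≤ y → z * x ≤ z * y
  *-monoˡ-≤ {z} {x} {y} 0≤z p = ≤-from (*-nonneg 0≤z (x≤y⇒0≤y-x p))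
    (solve 3 (λ z x y → z :* (y :- x) := z :* y :- z :* x) refl z x y)

  *-monoʳ-≤ : ∀ {z x y} → 0# ≤ z → x ≤ y → x * z ≤ y * z
  *-monoʳ-≤ {z} {x} {y} 0≤z p = begin
    x * z   ≈⟨ *-comm x z ⟩
    z * x   ≤⟨ *-monoˡ-≤ 0≤z p ⟩
    z * y   ≈⟨ *-comm z y ⟩
    y * z   ∎

  *-mono-≤ : ∀ {x y u v} → 0# ≤ x → 0# ≤ v → x ≤ y → u ≤ v → x * u ≤ y * v
  *-mono-≤ 0≤x 0≤v x≤y u≤v = ≤.trans (*-monoˡ-≤ 0≤x u≤v) (*-monoʳ-≤ 0≤v x≤y)

  0≤1 : 0# ≤ 1#
  0≤1 = ≤.trans (x*x-nonneg 1#) (≤.reflexive (*-identityˡ 1#))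

  1≰0 : ¬ 1# ≤ 0#
  1≰0 1≤0 = 0≉1 (≤.antisym 0≤1 1≤0)

  x+y≤x⇒y≤0 : ∀ {x y} → x + y ≤ x → y ≤ 0#
  x+y≤x⇒y≤0 {x} {y} p = ≤-from (x≤y⇒0≤y-x p)
    (solve 2 (λ x y → x :- (x :+ y) := con (+ 0) :- y) refl x y)

  _≤?_ : ∀ x y → Dec (x ≤ y)
  x ≤? y = em

  ≰⇒≥ : ∀ {x y} → ¬ x ≤ y → y ≤ x
  ≰⇒≥ {x} {y} x≰y with ≤.total x y
  ... | inj₁ x≤y = contradiction x≤y x≰y
  ... | inj₂ y≤x = y≤x

  ≰⇒0<- : ∀ {x y} → ¬ x ≤ y → 0# < x - y
  ≰⇒0<- {x} {y} x≰y = x≤y⇒0≤y-x (≰⇒≥ x≰y) , λ 0≈x-y →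
    x≰y (≤.reflexive (begin-equality
      x              ≈⟨ solve 2 (λ x y → x := (x :- y) :+ y) refl x y ⟩
      (x - y) + y    ≈⟨ +-congʳ 0≈x-y ⟨
      0# + y         ≈⟨ +-identityˡ y ⟩
      y              ∎))

  <⇒≱ : ∀ {x y} → x < y → ¬ y ≤ x
  <⇒≱ (x≤y , x≉y) y≤x = x≉y (≤.antisym x≤y y≤x)

  x*x≈0⇒x≈0 : ∀ {x} → x * x ≈ 0# → x ≈ 0#
  x*x≈0⇒x≈0 {x} x*x≈0 with em {x ≈ 0#}
  ... | yes x≈0 = x≈0
  ... | no  x≉0 = begin-equality
    x                  ≈⟨ *-identityʳ x ⟨
    x * 1#             ≈⟨ *-congˡ (⁻¹-inverseʳ x≉0) ⟨
    x * (x * x ⁻¹)     ≈⟨ *-assoc x x _ ⟨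
    x * x * x ⁻¹       ≈⟨ *-congʳ x*x≈0 ⟩
    0# * x ⁻¹          ≈⟨ zeroˡ _ ⟩
    0#                 ∎

  x*x≤y*y⇒x≤y : ∀ {x y} → 0# ≤ y → x * x ≤ y * y → x ≤ y
  x*x≤y*y⇒x≤y {x} {y} 0≤y x²≤y² with ≤.total x y
  ... | inj₁ x≤y = x≤y
  ... | inj₂ y≤x = ≤.reflexive (begin-equality
    x              ≈⟨ solve 2 (λ x y → x := (x :- y) :+ y) refl x y ⟩
    (x - y) + y    ≈⟨ +-congʳ (x*x≈0⇒x≈0 (≤.antisym [x-y]²≤0 (x*x-nonneg _))) ⟩
    0# + y         ≈⟨ +-identityˡ y ⟩
    y              ∎)
    where
    -- (x - y)² = (x² - y²) - 2y(x - y), where the first bracket is at most 0 and y(x - y) is at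
    -- least 0.
    [x-y]²≤0 : (x - y) * (x - y) ≤ 0#
    [x-y]²≤0 = ≤-from
      (+-nonneg (x≤y⇒0≤y-x x²≤y²)
        (+-nonneg (*-nonneg 0≤y (x≤y⇒0≤y-x y≤x)) (*-nonneg 0≤y (x≤y⇒0≤y-x y≤x))))
      (solve 2 (λ x y → (y :* y :- x :* x) :+ (y :* (x :- y) :+ y :* (x :- y))
                        := con (+ 0) :- (x :- y) :* (x :- y)) refl x y)

  0<x⇒0≤x⁻¹ : ∀ {x} → 0# < x → 0# ≤ x ⁻¹
  0<x⇒0≤x⁻¹ {x} (0≤x , 0≉x) with ≤.total 0# (x ⁻¹)
  ... | inj₁ 0≤x⁻¹ = 0≤x⁻¹
  ... | inj₂ x⁻¹≤0 = contradiction (begin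
    1#          ≈⟨ ⁻¹-inverseʳ (0≉x ∘ sym) ⟨
    x * x ⁻¹    ≤⟨ *-monoˡ-≤ 0≤x x⁻¹≤0 ⟩
    x * 0#      ≈⟨ zeroʳ x ⟩
    0#          ∎) 1≰0

  0<x⇒x*x⁻¹≈1 : ∀ {x} → 0# < x → x * x ⁻¹ ≈ 1#
  0<x⇒x*x⁻¹≈1 (_ , 0≉x) = ⁻¹-inverseʳ (0≉x ∘ sym)

  0<1+x : ∀ {x} → 0# ≤ x → 0# < 1# + x
  0<1+x {x} 0≤x = +-nonneg 0≤1 0≤x , λ 0≈1+x → 1≰0 (begin
    1#        ≈⟨ +-identityʳ 1# ⟨
    1# + 0#   ≤⟨ +-monoʳ-≤ 1# 0≤x ⟩
    1# + x    ≈⟨ 0≈1+x ⟨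
    0#        ∎)

  -- For x, y ≥ 0 a tolerance η ≤ 1 with η y ≤ x; the denominator is then nonzero.
  shrink : Carrier → Carrier → Carrier
  shrink x y = x * (1# + (y + x)) ⁻¹

  module _ {x y} (0≤x : 0# ≤ x) (0≤y : 0# ≤ y) where
    private
      0<1+y+x : 0# < 1# + (y + x)
      0<1+y+x = 0<1+x (+-nonneg 0≤y 0≤x)

      η : Carrier
      η = shrink x y

      η*[1+y+x]≈x : η * (1# + (y + x)) ≈ x
      η*[1+y+x]≈x = begin-equality
        x * (1# + (y + x)) ⁻¹ * (1# + (y + x))      ≈⟨ *-assoc x _ _ ⟩
        x * ((1# + (y + x)) ⁻¹ * (1# + (y + x)))    ≈⟨ *-congˡ (*-comm _ _) ⟩
        x * ((1# + (y + x)) * (1# + (y + x)) ⁻¹)    ≈⟨ *-congˡ (0<x⇒x*x⁻¹≈1 0<1+y+x) ⟩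
        x * 1#                                      ≈⟨ *-identityʳ x ⟩
        x                                           ∎

    0≤shrink : 0# ≤ η
    0≤shrink = *-nonneg 0≤x (0<x⇒0≤x⁻¹ 0<1+y+x)

    shrink≤1 : η ≤ 1#
    shrink≤1 = ≤-from (*-nonneg (+-nonneg 0≤1 0≤y) (0<x⇒0≤x⁻¹ 0<1+y+x))
      (trans (solve 3 (λ x y i → (con (+ 1) :+ y) :* i := (con (+ 1) :+ (y :+ x)) :* i :- x :* i)
                refl x y ((1# + (y + x)) ⁻¹))
             (+-congʳ (0<x⇒x*x⁻¹≈1 0<1+y+x)))

    shrink-≤ : η * y ≤ x
    shrink-≤ = ≤-from (*-nonneg 0≤shrink (+-nonneg 0≤1 0≤x))
      (trans (solve 3 (λ x y i → i :* (con (+ 1) :+ x) := i :* (con (+ 1) :+ (y :+ x)) :- i :* y)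
                refl x y η)
             (+-congʳ η*[1+y+x]≈x))

    -- The way limit arguments end below: a gap x is closed by showing that the tolerance made from
    -- it cannot be positive.
    shrink≤0⇒ : η ≤ 0# → x ≤ 0#
    shrink≤0⇒ η≤0 = begin
      x                        ≈⟨ η*[1+y+x]≈x ⟨
      η * (1# + (y + x))       ≤⟨ *-monoʳ-≤ (proj₁ 0<1+y+x) η≤0 ⟩
      0# * (1# + (y + x))      ≈⟨ zeroˡ _ ⟩
      0#                       ∎

  0<shrink : ∀ {x y} → 0# < x → 0# ≤ y → 0# < shrink x y
  0<shrink 0<x@(0≤x , _) 0≤y =
    0≤shrink 0≤x 0≤y , λ 0≈η → <⇒≱ 0<x (shrink≤0⇒ 0≤x 0≤y (≤.reflexive (sym 0≈η)))

  -- The factor `K` absorbs whatever multiple of δ a chain of estimates has collected. The tolerance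
  -- is shrunk against 1 + K, one more than the estimate uses up, so that a positive gap is
  -- contradictory.
  ≤-limit : ∀ {x y K} → 0# ≤ K → (∀ {δ} → 0# < δ → x ≤ y + δ * K) → x ≤ y
  ≤-limit {x} {y} {K} 0≤K approx with x ≤? y
  ... | yes x≤y = x≤y
  ... | no  x≰y = contradiction x-y≤0 (<⇒≱ 0<x-y)
    where
    0<x-y : 0# < x - y
    0<x-y = ≰⇒0<- x≰y

    η : Carrier
    η = shrink (x - y) (1# + K)

    -- x − y ≤ η K and η K + η ≤ x − y
    η≤0 : η ≤ 0#
    η≤0 = ≤-from
      (+-nonneg (x≤y⇒0≤y-x (approx (0<shrink 0<x-y (+-nonneg 0≤1 0≤K))))
                (x≤y⇒0≤y-x (shrink-≤ (proj₁ 0<x-y) (+-nonneg 0≤1 0≤K))))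
      (solve 4 (λ x y η K → (y :+ η :* K :- x) :+ (x :- y :- η :* (con (+ 1) :+ K))
                            := con (+ 0) :- η) refl x y η K)

    x-y≤0 : x - y ≤ 0#
    x-y≤0 = shrink≤0⇒ (proj₁ 0<x-y) (+-nonneg 0≤1 0≤K) η≤0

  -- `√ x 0≤x` unfolds to the first projection of this same instance of `complete`; the two omitted
  -- arguments are the proofs local to its definition, recovered by unification.
  √-isSupremum : ∀ x (0≤x : 0# ≤ x) → IsSupremum (λ y → y * y ≤ x) (√ x 0≤x)
  √-isSupremum x 0≤x = proj₂ (complete (λ y → y * y ≤ x) _ _)

  0≤√ : ∀ x (0≤x : 0# ≤ x) → 0# ≤ √ x 0≤x
  0≤√ x 0≤x = proj₁ (√-isSupremum x 0≤x) (≤.trans (≤.reflexive (zeroˡ 0#)) 0≤x)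

  -- Perturbation of the supremum s by a tolerance η made from the gap: if s² were below x, then s +
  -- η would still belong to the set; if it were above x, then s - η would already be an upper
  -- bound.
  √*√≈ : ∀ x (0≤x : 0# ≤ x) → √ x 0≤x * √ x 0≤x ≈ x
  √*√≈ x 0≤x = ≤.antisym s*s≤x x≤s*s
    where
    s : Carrier
    s = √ x 0≤x

    0≤s : 0# ≤ s
    0≤s = 0≤√ x 0≤x

    0≤2s+1 : 0# ≤ s + s + 1#
    0≤2s+1 = +-nonneg (+-nonneg 0≤s 0≤s) 0≤1

    x≤s*s : x ≤ s * s
    x≤s*s with ≤.total x (s * s)
    ... | inj₁ x≤s*s = x≤s*s
    ... | inj₂ s*s≤x = ≤-from (x≤y⇒0≤y-x (shrink≤0⇒ 0≤d 0≤2s+1 η≤0))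
      (solve 2 (λ x s → con (+ 0) :- (x :- s :* s) := s :* s :- x) refl x s)
      where
      0≤d : 0# ≤ x - s * s
      0≤d = x≤y⇒0≤y-x s*s≤x

      η : Carrier
      η = shrink (x - s * s) (s + s + 1#)

      -- (s + η)² = s² + η(2s + η) ≤ s² + η(2s + 1) because η ≤ 1, and η was shrunk against 2s + 1
      -- to keep this below x.
      [s+η]²≤x : (s + η) * (s + η) ≤ x
      [s+η]²≤x = ≤-from
        (+-nonneg (x≤y⇒0≤y-x (shrink-≤ 0≤d 0≤2s+1))
                  (*-nonneg (0≤shrink 0≤d 0≤2s+1) (x≤y⇒0≤y-x (shrink≤1 0≤d 0≤2s+1))))
        (solve 3 (λ x s η → (x :- s :* s :- η :* (s :+ s :+ con (+ 1))) :+ η :* (con (+ 1) :- η)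
                            := x :- (s :+ η) :* (s :+ η)) refl x s η)

      η≤0 : η ≤ 0#
      η≤0 = x+y≤x⇒y≤0 (proj₁ (√-isSupremum x 0≤x) [s+η]²≤x)

    s*s≤x : s * s ≤ x
    s*s≤x with ≤.total (s * s) x
    ... | inj₁ s*s≤x = s*s≤x
    ... | inj₂ x≤s*s = ≤-from (x≤y⇒0≤y-x (shrink≤0⇒ 0≤d 0≤2s η≤0))
      (solve 2 (λ x s → con (+ 0) :- (s :* s :- x) := x :- s :* s) refl x s)
      where
      0≤2s : 0# ≤ s + s
      0≤2s = +-nonneg 0≤s 0≤s

      0≤d : 0# ≤ s * s - x
      0≤d = x≤y⇒0≤y-x x≤s*s

      η : Carrier
      η = shrink (s * s - x) (s + s)

      0<D : 0# < 1# + (s + s + (s * s - x))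
      0<D = 0<1+x (+-nonneg 0≤2s 0≤d)

      D⁻¹ : Carrier
      D⁻¹ = (1# + (s + s + (s * s - x))) ⁻¹

      -- With D = 1 + 2s + d for d = s² − x, a y with y² ≤ x satisfies
      -- d ≤ (s − y)(s + y) ≤ (s − y) D.
      bound : ∀ {y} → y * y ≤ x → y ≤ s - η
      bound {y} y*y≤x = ≤-from
        (*-nonneg (0<x⇒0≤x⁻¹ 0<D)
          (+-nonneg (x≤y⇒0≤y-x y*y≤x)
            (*-nonneg 0≤s-y (+-nonneg (+-nonneg 0≤1 0≤s-y) 0≤d))))
        (begin-equality
          D⁻¹ * ((x - y * y) + (s - y) * (1# + (s - y) + (s * s - x)))
            ≈⟨ solve 4 (λ i x y s → i :* ((x :- y :* y) :+ (s :- y) :* (con (+ 1) :+ (s :- y) :+ (s :* s :- x)))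
                 := (s :- y) :* ((con (+ 1) :+ (s :+ s :+ (s :* s :- x))) :* i) :- (s :* s :- x) :* i)
                 refl D⁻¹ x y s ⟩
          (s - y) * ((1# + (s + s + (s * s - x))) * D⁻¹) - η
            ≈⟨ +-congʳ (trans (*-congˡ (0<x⇒x*x⁻¹≈1 0<D)) (*-identityʳ _)) ⟩
          (s - y) - η
            ≈⟨ solve 3 (λ s y η → (s :- y) :- η := (s :- η) :- y) refl s y η ⟩
          (s - η) - y
            ∎)
        where
        0≤s-y : 0# ≤ s - y
        0≤s-y = x≤y⇒0≤y-x (proj₁ (√-isSupremum x 0≤x) y*y≤x)

      η≤0 : η ≤ 0#
      η≤0 = ≤-from (x≤y⇒0≤y-x (proj₂ (√-isSupremum x 0≤x) bound))
        (solve 2 (λ s η → s :- η :- s := con (+ 0) :- η) refl s η)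

  -- The limit is the supremum of the lower estimates `a δ p - δ`; the hypothesis says that every
  -- `a δ p + δ` bounds all of them from above. Indexing by tolerances avoids the choice of a
  -- sequence.
  cauchy-limit : (a : ∀ δ → 0# < δ → Carrier) →
    (∀ {δ δ′} p p′ → a δ p ≤ a δ′ p′ + (δ + δ′)) →
    ∃[ L ] ∀ {δ} p → a δ p ≤ L + δ × L ≤ a δ p + δ
  cauchy-limit a cauchy = proj₁ s , λ {δ} p →
      ≤-from (x≤y⇒0≤y-x (proj₁ (proj₂ s) (δ , p , refl)))
        (solve 3 (λ L a δ → L :- (a :- δ) := L :+ δ :- a) refl (proj₁ s) (a δ p) δ)
    , proj₂ (proj₂ s) (bound p)
    where
    LowerEstimate : Pred Carrier ℓ
    LowerEstimate v = ∃[ δ ] Σ (0# < δ) λ p → v ≈ a δ p - δ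

    bound : ∀ {δ} p → IsUpperBound LowerEstimate (a δ p + δ)
    bound {δ} p {v} (δ′ , p′ , v≈) = ≤-from (x≤y⇒0≤y-x (cauchy p′ p))
      (begin-equality
        a δ p + (δ′ + δ) - a δ′ p′
          ≈⟨ solve 4 (λ a b δ δ′ → a :+ (δ′ :+ δ) :- b := (a :+ δ) :- (b :- δ′)) refl (a δ p) (a δ′ p′) δ δ′ ⟩
        (a δ p + δ) - (a δ′ p′ - δ′)
          ≈⟨ +-congˡ (-‿cong v≈) ⟨
        (a δ p + δ) - v
          ∎)

    0<1 : 0# < 1#
    0<1 = 0≤1 , 0≉1

    s : ∃[ L ] IsSupremum LowerEstimate L
    s = complete LowerEstimate (_ , 1# , 0<1 , refl) (_ , bound 0<1)

  -- If no natural number reached x, the naturals would have a supremum s; since n + 1 ≤ s for all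
  -- n, s - 1 would be a smaller upper bound.
  archimedean : ∀ x → ∃[ n ] x ≤ fromℕ n
  archimedean x with em {∃[ n ] x ≤ fromℕ n}
  ... | yes p = p
  ... | no ¬p = contradiction 1≤0 1≰0
    where
    IsNatural : Pred Carrier ℓ
    IsNatural v = ∃[ n ] v ≈ fromℕ n

    sup : ∃[ s ] IsSupremum IsNatural s
    sup = complete IsNatural (0# , 0 , refl)
      (x , λ { (n , v≈n) → ≤.trans (≤.reflexive v≈n) (≰⇒≥ (λ x≤n → ¬p (n , x≤n))) })

    s : Carrier
    s = proj₁ sup

    1≤0 : 1# ≤ 0#
    1≤0 = ≤-from (x≤y⇒0≤y-x (proj₂ (proj₂ sup) {s - 1#} λ { {v} (n , v≈n) →
        ≤-from (x≤y⇒0≤y-x (proj₁ (proj₂ sup) (suc n , refl)))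
          (trans (solve 2 (λ s n → s :- (con (+ 1) :+ n) := (s :- con (+ 1)) :- n) refl s (fromℕ n))
                 (+-congˡ (-‿cong (sym v≈n)))) }))
      (solve 1 (λ s → s :- con (+ 1) :- s := con (+ 0) :- con (+ 1)) refl s)

  0≤fromℕ : ∀ n → 0# ≤ fromℕ n
  0≤fromℕ zero    = ≤.refl
  0≤fromℕ (suc n) = +-nonneg 0≤1 (0≤fromℕ n)

  fromℕ-mono-≤ : ∀ {m n} → m ℕ.≤ n → fromℕ m ≤ fromℕ n
  fromℕ-mono-≤ {n = n} ℕ.z≤n = 0≤fromℕ n
  fromℕ-mono-≤ (ℕ.s≤s m≤n)   = +-monoʳ-≤ 1# (fromℕ-mono-≤ m≤n)

  -- Descent from a known bound: the first n whose predecessor fails to bound x is least, by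
  -- monotonicity of `fromℕ`. Reaching `zero` gives 0, also for negative x.
  ceiling-below : ∀ {x} n → x ≤ fromℕ n → ∃[ m ] IsCeiling x m
  ceiling-below zero x≤0 = 0 , x≤0 , λ _ → ℕ.z≤n
  ceiling-below {x} (suc n) x≤1+n with x ≤? fromℕ n
  ... | yes x≤n = ceiling-below n x≤n
  ... | no  x≰n = suc n , x≤1+n , λ x≤m →
    ℕ.≰⇒> λ m≤n → x≰n (≤.trans x≤m (fromℕ-mono-≤ m≤n))

  ceiling : ∀ x → ∃[ n ] IsCeiling x n
  ceiling x = let n , x≤n = archimedean x in ceiling-below n x≤n

  sum-mono-≤ : ∀ {n} {f g : Fin n → Carrier} → (∀ i → f i ≤ g i) → sum f ≤ sum g
  sum-mono-≤ {zero}  f≤g = ≤.refl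
  sum-mono-≤ {suc n} f≤g = +-mono-≤ (f≤g zero) (sum-mono-≤ (f≤g ∘ suc))

  sum-cong : ∀ {n} {f g : Fin n → Carrier} → (∀ i → f i ≈ g i) → sum f ≈ sum g
  sum-cong = sum-cong-≋

  sum-nonneg : ∀ {n} {f : Fin n → Carrier} → (∀ i → 0# ≤ f i) → 0# ≤ sum f
  sum-nonneg {zero}  0≤f = ≤.refl
  sum-nonneg {suc n} 0≤f = +-nonneg (0≤f zero) (sum-nonneg (0≤f ∘ suc))

-- Complex numbers: ring laws, modulus, limits.

module ComplexProperties {ℓ} (em : ExcludedMiddle ℓ) (R : CompleteOrderedField ℓ) where
  open CompleteOrderedField R hiding (sum; zero)
  open RealProperties em R
  open PosetReasoning poset
  open Complex R using (ℂ; _+i_; re; im; ofReal; ∣_∣)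
  private module C = Complex R

  commutativeRingℂ : CommutativeRing ℓ ℓ
  commutativeRingℂ = record
    { RawRing C.rawRing
    ; isCommutativeRing = record
      { isRing = record
        { +-isAbelianGroup = record
          { isGroup = record
            { isMonoid = record
              { isSemigroup = record
                { isMagma = record
                  { isEquivalence = Setoid.isEquivalence C.setoid
                  ; ∙-cong = λ (p , q) (p′ , q′) → +-cong p p′ , +-cong q q′
                  }
                ; assoc = λ _ _ _ → +-assoc _ _ _ , +-assoc _ _ _
                }
              ; identity = (λ _ → +-identityˡ _ , +-identityˡ _) , (λ _ → +-identityʳ _ , +-identityʳ _)
              }
            ; inverse = (λ _ → -‿inverseˡ _ , -‿inverseˡ _) , (λ _ → -‿inverseʳ _ , -‿inverseʳ _)
            ; ⁻¹-cong = λ (p , q) → -‿cong p , -‿cong q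
            }
          ; comm = λ _ _ → +-comm _ _ , +-comm _ _
          }
        ; *-cong = λ (p , q) (p′ , q′) →
              +-cong (*-cong p p′) (-‿cong (*-cong q q′))
            , +-cong (*-cong p q′) (*-cong q p′)
        ; *-assoc = λ (a +i b) (c +i d) (e +i f) →
              solve 6 (λ a b c d e f → (a :* c :- b :* d) :* e :- (a :* d :+ b :* c) :* f
                                       := a :* (c :* e :- d :* f) :- b :* (c :* f :+ d :* e)) refl a b c d e f
            , solve 6 (λ a b c d e f → (a :* c :- b :* d) :* f :+ (a :* d :+ b :* c) :* e
                                       := a :* (c :* f :+ d :* e) :+ b :* (c :* e :- d :* f)) refl a b c d e f
        ; *-identity =
              (λ (a +i b) → solve 2 (λ a b → con (+ 1) :* a :- con (+ 0) :* b := a) refl a b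
                          , solve 2 (λ a b → con (+ 1) :* b :+ con (+ 0) :* a := b) refl a b)
            , (λ (a +i b) → solve 2 (λ a b → a :* con (+ 1) :- b :* con (+ 0) := a) refl a b
                          , solve 2 (λ a b → a :* con (+ 0) :+ b :* con (+ 1) := b) refl a b)
        ; distrib =
              (λ (a +i b) (c +i d) (e +i f) →
                  solve 6 (λ a b c d e f → a :* (c :+ e) :- b :* (d :+ f)
                                           := (a :* c :- b :* d) :+ (a :* e :- b :* f)) refl a b c d e f
                , solve 6 (λ a b c d e f → a :* (d :+ f) :+ b :* (c :+ e)
                                           := (a :* d :+ b :* c) :+ (a :* f :+ b :* e)) refl a b c d e f)
            , (λ (a +i b) (c +i d) (e +i f) →
                  solve 6 (λ a b c d e f → (c :+ e) :* a :- (d :+ f) :* b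
                                           := (c :* a :- d :* b) :+ (e :* a :- f :* b)) refl a b c d e f
                , solve 6 (λ a b c d e f → (c :+ e) :* b :+ (d :+ f) :* a
                                           := (c :* b :+ d :* a) :+ (e :* b :+ f :* a)) refl a b c d e f)
        }
      ; *-comm = λ (a +i b) (c +i d) →
            solve 4 (λ a b c d → a :* c :- b :* d := c :* a :- d :* b) refl a b c d
          , solve 4 (λ a b c d → a :* d :+ b :* c := c :* b :+ d :* a) refl a b c d
      }
    }

  module CR = CommutativeRing commutativeRingℂ
  open IntegerCoefficientSolver commutativeRingℂ public
    using () renaming (solve to solveℂ; con to conℂ; _:=_ to _⊜_; _:+_ to _⊕_; _:*_ to _⊗_; _:-_ to _⊝_; :-_ to ⊝′_)
  module ΣC = SemiringSum CR.semiring

  re-sum : ∀ {n} (f : Fin n → ℂ) → re (C.sum f) ≈ sum (re ∘ f)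
  re-sum {zero}  f = refl
  re-sum {suc n} f = +-congˡ (re-sum (f ∘ suc))

  im-sum : ∀ {n} (f : Fin n → ℂ) → im (C.sum f) ≈ sum (im ∘ f)
  im-sum {zero}  f = refl
  im-sum {suc n} f = +-congˡ (im-sum (f ∘ suc))

  ofReal-cong : ∀ {x y} → x ≈ y → ofReal x CR.≈ ofReal y
  ofReal-cong x≈y = x≈y , refl

  ofReal-* : ∀ x y → ofReal (x * y) CR.≈ ofReal x CR.* ofReal y
  ofReal-* x y =
      solve 2 (λ x y → x :* y := x :* y :- con (+ 0) :* con (+ 0)) refl x y
    , solve 2 (λ x y → con (+ 0) := x :* con (+ 0) :+ con (+ 0) :* y) refl x y

  ofReal-- : ∀ x y → ofReal (x - y) CR.≈ ofReal x CR.- ofReal y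
  ofReal-- x y = refl , sym (-‿inverseʳ 0#)

  ofReal-sum : ∀ {n} (f : Fin n → Carrier) → ofReal (sum f) CR.≈ C.sum (ofReal ∘ f)
  ofReal-sum {zero}  f = CR.refl
  ofReal-sum {suc n} f =
    CR.trans (refl , sym (+-identityˡ 0#)) (CR.+-congˡ (ofReal-sum (f ∘ suc)))

  -- Polynomial in the coordinates, so that inequalities between moduli become ring identities after
  -- squaring.
  ∣_∣² : ℂ → Carrier
  ∣ z ∣² = re z * re z + im z * im z

  0≤∣∣ : ∀ z → 0# ≤ ∣ z ∣
  0≤∣∣ z = 0≤√ _ _

  ∣∣*∣∣≈∣∣² : ∀ z → ∣ z ∣ * ∣ z ∣ ≈ ∣ z ∣²
  ∣∣*∣∣≈∣∣² z = √*√≈ _ _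

  ∣∣²≤⇒∣∣≤ : ∀ {z x} → 0# ≤ x → ∣ z ∣² ≤ x * x → ∣ z ∣ ≤ x
  ∣∣²≤⇒∣∣≤ {z} 0≤x p = x*x≤y*y⇒x≤y 0≤x (≤.trans (≤.reflexive (∣∣*∣∣≈∣∣² z)) p)

  ∣∣²-mono : ∀ {z w} → ∣ z ∣² ≤ ∣ w ∣² → ∣ z ∣ ≤ ∣ w ∣
  ∣∣²-mono {z} {w} p = ∣∣²≤⇒∣∣≤ (0≤∣∣ w) (≤.trans p (≤.reflexive (sym (∣∣*∣∣≈∣∣² w))))

  ∣∣-reflexive : ∀ {z w} → z CR.≈ w → ∣ z ∣ ≤ ∣ w ∣
  ∣∣-reflexive (p , q) = ∣∣²-mono (≤.reflexive (+-cong (*-cong p p) (*-cong q q)))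

  ∣z-w∣≤∣w-z∣ : ∀ z w → ∣ z CR.- w ∣ ≤ ∣ w CR.- z ∣
  ∣z-w∣≤∣w-z∣ (a +i b) (c +i d) = ∣∣²-mono (≤.reflexive
    (solve 4 (λ a b c d → (a :- c) :* (a :- c) :+ (b :- d) :* (b :- d)
                          := (c :- a) :* (c :- a) :+ (d :- b) :* (d :- b)) refl a b c d))

  ∣ofReal∣≤ : ∀ {x} → 0# ≤ x → ∣ ofReal x ∣ ≤ x
  ∣ofReal∣≤ {x} 0≤x = ∣∣²≤⇒∣∣≤ 0≤x (≤.reflexive (solve 1 (λ x → x :* x :+ con (+ 0) :* con (+ 0) := x :* x) refl x))

  ∣ofReal∣*∣ofReal∣ : ∀ x → ∣ ofReal x ∣ * ∣ ofReal x ∣ ≈ x * x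
  ∣ofReal∣*∣ofReal∣ x = trans (∣∣*∣∣≈∣∣² (ofReal x))
    (solve 1 (λ x → x :* x :+ con (+ 0) :* con (+ 0) := x :* x) refl x)

  ∣ofReal-re∣≤ : ∀ z → ∣ ofReal (re z) ∣ ≤ ∣ z ∣
  ∣ofReal-re∣≤ (a +i b) = ∣∣²-mono (≤-from (x*x-nonneg b)
    (solve 2 (λ a b → b :* b := (a :* a :+ b :* b) :- (a :* a :+ con (+ 0) :* con (+ 0))) refl a b))

  re≤∣∣ : ∀ z → re z ≤ ∣ z ∣
  re≤∣∣ z@(a +i b) = x*x≤y*y⇒x≤y (0≤∣∣ z) (≤-from (x*x-nonneg b)
    (trans (solve 2 (λ a b → b :* b := (a :* a :+ b :* b) :- a :* a) refl a b)
           (+-congʳ (sym (∣∣*∣∣≈∣∣² z)))))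

  im≤∣∣ : ∀ z → im z ≤ ∣ z ∣
  im≤∣∣ z@(a +i b) = x*x≤y*y⇒x≤y (0≤∣∣ z) (≤-from (x*x-nonneg a)
    (trans (solve 2 (λ a b → a :* a := (a :* a :+ b :* b) :- b :* b) refl a b)
           (+-congʳ (sym (∣∣*∣∣≈∣∣² z)))))

  ∣z*w∣≤ : ∀ z w → ∣ z CR.* w ∣ ≤ ∣ z ∣ * ∣ w ∣
  ∣z*w∣≤ z@(a +i b) w@(c +i d) = ∣∣²≤⇒∣∣≤ (*-nonneg (0≤∣∣ z) (0≤∣∣ w)) (≤.reflexive (begin-equality
    ∣ z CR.* w ∣²
      ≈⟨ solve 4 (λ a b c d → (a :* c :- b :* d) :* (a :* c :- b :* d) :+ (a :* d :+ b :* c) :* (a :* d :+ b :* c)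
                              := (a :* a :+ b :* b) :* (c :* c :+ d :* d)) refl a b c d ⟩
    ∣ z ∣² * ∣ w ∣²
      ≈⟨ *-cong (∣∣*∣∣≈∣∣² z) (∣∣*∣∣≈∣∣² w) ⟨
    ∣ z ∣ * ∣ z ∣ * (∣ w ∣ * ∣ w ∣)
      ≈⟨ solve 2 (λ u v → u :* u :* (v :* v) := u :* v :* (u :* v)) refl ∣ z ∣ ∣ w ∣ ⟩
    ∣ z ∣ * ∣ w ∣ * (∣ z ∣ * ∣ w ∣)
      ∎))

  -- Lagrange's identity (ac + bd)² + (ad − bc)² = (a² + b²)(c² + d²)
  cauchy-schwarz : ∀ z w → re z * re w + im z * im w ≤ ∣ z ∣ * ∣ w ∣
  cauchy-schwarz z@(a +i b) w@(c +i d) = x*x≤y*y⇒x≤y (*-nonneg (0≤∣∣ z) (0≤∣∣ w))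
    (≤-from (x*x-nonneg (a * d - b * c)) (begin-equality
      (a * d - b * c) * (a * d - b * c)
        ≈⟨ solve 4 (λ a b c d → (a :* d :- b :* c) :* (a :* d :- b :* c)
             := (a :* a :+ b :* b) :* (c :* c :+ d :* d) :- (a :* c :+ b :* d) :* (a :* c :+ b :* d)) refl a b c d ⟩
      ∣ z ∣² * ∣ w ∣² - t * t
        ≈⟨ +-congʳ (*-cong (∣∣*∣∣≈∣∣² z) (∣∣*∣∣≈∣∣² w)) ⟨
      ∣ z ∣ * ∣ z ∣ * (∣ w ∣ * ∣ w ∣) - t * t
        ≈⟨ +-congʳ (solve 2 (λ u v → u :* u :* (v :* v) := u :* v :* (u :* v)) refl ∣ z ∣ ∣ w ∣) ⟩
      ∣ z ∣ * ∣ w ∣ * (∣ z ∣ * ∣ w ∣) - t * t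
        ∎))
    where
    t : Carrier
    t = a * c + b * d

  ∣z+w∣≤ : ∀ z w → ∣ z CR.+ w ∣ ≤ ∣ z ∣ + ∣ w ∣
  ∣z+w∣≤ z@(a +i b) w@(c +i d) = ∣∣²≤⇒∣∣≤ (+-nonneg (0≤∣∣ z) (0≤∣∣ w)) (begin
    ∣ z CR.+ w ∣²
      ≈⟨ solve 4 (λ a b c d → (a :+ c) :* (a :+ c) :+ (b :+ d) :* (b :+ d)
           := (a :* a :+ b :* b) :+ (c :* c :+ d :* d) :+ ((a :* c :+ b :* d) :+ (a :* c :+ b :* d))) refl a b c d ⟩
    ∣ z ∣² + ∣ w ∣² + ((a * c + b * d) + (a * c + b * d))
      ≤⟨ +-mono-≤ (≤.reflexive (sym (+-cong (∣∣*∣∣≈∣∣² z) (∣∣*∣∣≈∣∣² w))))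
                  (+-mono-≤ (cauchy-schwarz z w) (cauchy-schwarz z w)) ⟩
    ∣ z ∣ * ∣ z ∣ + ∣ w ∣ * ∣ w ∣ + (∣ z ∣ * ∣ w ∣ + ∣ z ∣ * ∣ w ∣)
      ≈⟨ solve 2 (λ u v → u :* u :+ v :* v :+ (u :* v :+ u :* v) := (u :+ v) :* (u :+ v)) refl ∣ z ∣ ∣ w ∣ ⟩
    (∣ z ∣ + ∣ w ∣) * (∣ z ∣ + ∣ w ∣)
      ∎)

  ∣z-w∣≤ : ∀ z w → ∣ z CR.- w ∣ ≤ ∣ z ∣ + ∣ w ∣
  ∣z-w∣≤ z w@(c +i d) = ≤.trans (∣z+w∣≤ z (CR.- w)) (+-monoʳ-≤ ∣ z ∣ (∣∣²-mono (≤.reflexive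
    (solve 2 (λ c d → (:- c) :* (:- c) :+ (:- d) :* (:- d) := c :* c :+ d :* d) refl c d))))

  ∣x-z∣≤∣x-y∣+∣y-z∣ : ∀ x y z → ∣ x CR.- z ∣ ≤ ∣ x CR.- y ∣ + ∣ y CR.- z ∣
  ∣x-z∣≤∣x-y∣+∣y-z∣ x y z = ≤.trans
    (∣∣-reflexive (solveℂ 3 (λ x y z → x ⊝ z ⊜ (x ⊝ y) ⊕ (y ⊝ z))
                     CR.refl x y z))
    (∣z+w∣≤ (x CR.- y) (y CR.- z))

  ∣0∣≤0 : ∣ CR.0# ∣ ≤ 0#
  ∣0∣≤0 = ∣ofReal∣≤ ≤.refl

  ∣sum∣≤ : ∀ {n} (f : Fin n → ℂ) → ∣ C.sum f ∣ ≤ sum (∣_∣ ∘ f)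
  ∣sum∣≤ {zero}  f = ∣0∣≤0
  ∣sum∣≤ {suc n} f = ≤.trans (∣z+w∣≤ _ _) (+-monoʳ-≤ _ (∣sum∣≤ (f ∘ suc)))

  ∣z-w∣≤0⇒z≈w : ∀ {z w} → ∣ z CR.- w ∣ ≤ 0# → z CR.≈ w
  ∣z-w∣≤0⇒z≈w {z} {w} p =
      ≤.antisym (cancel (≤.trans (re≤∣∣ (z CR.- w)) p)) (cancel (≤.trans (re≤∣∣ (w CR.- z)) q))
    , ≤.antisym (cancel (≤.trans (im≤∣∣ (z CR.- w)) p)) (cancel (≤.trans (im≤∣∣ (w CR.- z)) q))
    where
    q : ∣ w CR.- z ∣ ≤ 0#
    q = ≤.trans (∣z-w∣≤∣w-z∣ w z) p

    cancel : ∀ {x y} → x - y ≤ 0# → x ≤ y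
    cancel {x} {y} p = ≤-from (x≤y⇒0≤y-x p)
      (solve 2 (λ x y → con (+ 0) :- (x :- y) := y :- x) refl x y)

  -- Limits of the two coordinates bound the distance to L only by 2δ. A detour through `z δ′ p′`
  -- gives δ + 3δ′, and letting δ′ vanish restores the sharp δ, which `IsIntegral` requires.
  cauchy-limitℂ : (z : ∀ δ → 0# < δ → ℂ) →
    (∀ {δ δ′} p p′ → ∣ z δ p CR.- z δ′ p′ ∣ ≤ δ + δ′) →
    ∃[ L ] ∀ {δ} p → ∣ z δ p CR.- L ∣ ≤ δ
  cauchy-limitℂ z cauchy = L , λ {δ} p → ≤-limit (+-nonneg 0≤1 (+-nonneg 0≤1 0≤1)) λ {δ′} p′ → begin
    ∣ z δ p CR.- L ∣
      ≤⟨ ∣x-z∣≤∣x-y∣+∣y-z∣ (z δ p) (z δ′ p′) L ⟩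
    ∣ z δ p CR.- z δ′ p′ ∣ + ∣ z δ′ p′ CR.- L ∣
      ≤⟨ +-mono-≤ (cauchy p p′) (near p′) ⟩
    (δ + δ′) + (δ′ + δ′)
      ≈⟨ solve 2 (λ δ δ′ → (δ :+ δ′) :+ (δ′ :+ δ′) := δ :+ δ′ :* (con (+ 1) :+ (con (+ 1) :+ con (+ 1)))) refl δ δ′ ⟩
    δ + δ′ * (1# + (1# + 1#))
      ∎
    where
    step : ∀ {u v c} → u - v ≤ c → u ≤ v + c
    step {u} {v} {c} p = ≤-from (x≤y⇒0≤y-x p) (solve 3 (λ u v c → c :- (u :- v) := v :+ c :- u) refl u v c)

    x = cauchy-limit (λ δ p → re (z δ p)) λ p p′ → step (≤.trans (re≤∣∣ (z _ p CR.- z _ p′)) (cauchy p p′))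
    y = cauchy-limit (λ δ p → im (z δ p)) λ p p′ → step (≤.trans (im≤∣∣ (z _ p CR.- z _ p′)) (cauchy p p′))

    -- The product equals δ² - (a - L)², so it turns the two-sided bound into a bound on a square.
    close : ∀ {a L δ} → a ≤ L + δ × L ≤ a + δ → 0# ≤ (L + δ - a) * (a + δ - L)
    close (p , q) = *-nonneg (x≤y⇒0≤y-x p) (x≤y⇒0≤y-x q)

    L : ℂ
    L = proj₁ x +i proj₁ y

    near : ∀ {δ} p → ∣ z δ p CR.- L ∣ ≤ δ + δ
    near {δ} p = ∣∣²≤⇒∣∣≤ (+-nonneg (proj₁ p) (proj₁ p))
      (≤-from (+-nonneg (+-nonneg (close (proj₂ x p)) (close (proj₂ y p)))
                        (+-nonneg (x*x-nonneg δ) (x*x-nonneg δ)))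
        (solve 5 (λ a b c d δ →
            (((c :+ δ :- a) :* (a :+ δ :- c)) :+ ((d :+ δ :- b) :* (b :+ δ :- d))) :+ (δ :* δ :+ δ :* δ)
            := (δ :+ δ) :* (δ :+ δ) :- ((a :- c) :* (a :- c) :+ (b :- d) :* (b :- d)))
          refl (re (z δ p)) (im (z δ p)) (proj₁ x) (proj₁ y) δ))

-- Finitely additive measures.

module MeasureProperties {ℓ} (em : ExcludedMiddle ℓ) (R : CompleteOrderedField ℓ) (S : MeasureSpace R) where
  open CompleteOrderedField R hiding (sum; zero)
  open MeasureSpace S
  open RealProperties em R
  open PosetReasoning poset

  𝒜-∩ : ∀ {A B} → A ∈ 𝒜 → B ∈ 𝒜 → (A ∩ B) ∈ 𝒜
  𝒜-∩ {A} {B} a b = 𝒜-resp (stable , λ (x∈A , x∈B) → λ { (inj₁ x∉A) → x∉A x∈A ; (inj₂ x∉B) → x∉B x∈B })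
    (𝒜-∁ (𝒜-∪ (𝒜-∁ a) (𝒜-∁ b)))
    where
    stable : ∁ (∁ A ∪ ∁ B) ⊆ A ∩ B
    stable {x} x∉ with em {x ∈ A} | em {x ∈ B}
    ... | yes x∈A | yes x∈B = x∈A , x∈B
    ... | no  x∉A | _       = contradiction (inj₁ x∉A) x∉
    ... | _       | no  x∉B = contradiction (inj₂ x∉B) x∉

  -- An empty set is disjoint from itself, so additivity applies to A ∪ A = A and gives 2μ(A) =
  -- μ(A).
  μ-∅ : ∀ {A} (a : A ∈ 𝒜) → (∀ {x} → x ∉ A) → μ a ≈ 0#
  μ-∅ {A} a empty = ≤.antisym (x+y≤x⇒y≤0 (≤.reflexive (begin-equality
    μ a + μ a       ≈⟨ μ-additive a a (λ (x∈A , _) → empty x∈A) ⟨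
    μ (𝒜-∪ a a)     ≈⟨ μ-cong (𝒜-∪ a a) a ((λ { (inj₁ x∈A) → x∈A ; (inj₂ x∈A) → x∈A }) , inj₁) ⟩
    μ a             ∎))) (0≤μ a)

  -- Induction splits off A ∩ B₀ and continues inside A minus B₀. Only points of A have to be
  -- covered, and this survives the passage to the smaller set with one B fewer. With no B left, A
  -- is empty.
  μ-decompose : ∀ {A} (a : A ∈ 𝒜) {n} {B : Fin n → Pred X ℓ} (b : ∀ i → B i ∈ 𝒜) →
    (∀ {i j} → i ≢ j → B i ⊥ B j) → (∀ {x} → x ∈ A → ∃[ i ] x ∈ B i) →
    μ a ≈ sum λ i → μ (𝒜-∩ a (b i))
  μ-decompose a {zero} b disjoint covers =
    μ-∅ a λ x∈A → contradiction (proj₁ (covers x∈A)) λ ()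
  μ-decompose {A} a {suc n} {B} b disjoint covers = begin-equality
    μ a
      ≈⟨ μ-cong a (𝒜-∪ a∩b₀ a∖b₀) (split , λ { (inj₁ (x∈A , _)) → x∈A ; (inj₂ (x∈A , _)) → x∈A }) ⟩
    μ (𝒜-∪ a∩b₀ a∖b₀)
      ≈⟨ μ-additive a∩b₀ a∖b₀ (λ ((_ , x∈B₀) , (_ , x∉B₀)) → x∉B₀ x∈B₀) ⟩
    μ a∩b₀ + μ a∖b₀
      ≈⟨ +-congˡ (μ-decompose a∖b₀ (b ∘ suc) (λ i≢j → disjoint (i≢j ∘ Fin.suc-injective)) covers′) ⟩
    μ a∩b₀ + sum (λ i → μ (𝒜-∩ a∖b₀ (b (suc i))))
      ≈⟨ +-congˡ (sum-cong λ i → μ-cong (𝒜-∩ a∖b₀ (b (suc i))) (𝒜-∩ a (b (suc i)))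
           ( (λ ((x∈A , _) , x∈Bᵢ) → x∈A , x∈Bᵢ)
           , (λ (x∈A , x∈Bᵢ) → (x∈A , λ x∈B₀ → disjoint (λ ()) (x∈B₀ , x∈Bᵢ)) , x∈Bᵢ))) ⟩
    μ a∩b₀ + sum (λ i → μ (𝒜-∩ a (b (suc i))))
      ∎
    where
    B₀ : Pred X ℓ
    B₀ = B zero

    a∩b₀ : (A ∩ B₀) ∈ 𝒜
    a∩b₀ = 𝒜-∩ a (b zero)

    a∖b₀ : (A ∩ ∁ B₀) ∈ 𝒜
    a∖b₀ = 𝒜-∩ a (𝒜-∁ (b zero))

    split : A ⊆ (A ∩ B₀) ∪ (A ∩ ∁ B₀)
    split {x} x∈A with em {x ∈ B₀}
    ... | yes x∈B₀ = inj₁ (x∈A , x∈B₀)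
    ... | no  x∉B₀ = inj₂ (x∈A , x∉B₀)

    covers′ : ∀ {x} → x ∈ A ∩ ∁ B₀ → ∃[ i ] x ∈ B (suc i)
    covers′ (x∈A , x∉B₀) with covers x∈A
    ... | zero  , x∈B₀ = contradiction x∈B₀ x∉B₀
    ... | suc i , x∈Bᵢ = i , x∈Bᵢ

  μ-partition : ∀ {A} (a : A ∈ 𝒜) {n} {B : Fin n → Pred X ℓ} (b : ∀ i → B i ∈ 𝒜) → (∀ i → B i ⊆ A) →
    (∀ {i j} → i ≢ j → B i ⊥ B j) → (∀ {x} → x ∈ A → ∃[ i ] x ∈ B i) →
    μ a ≈ sum λ i → μ (b i)
  μ-partition a b B⊆A disjoint covers = trans (μ-decompose a b disjoint covers)
    (sum-cong λ i → μ-cong (𝒜-∩ a (b i)) (b i) (proj₂ , λ x∈Bᵢ → B⊆A i x∈Bᵢ , x∈Bᵢ))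

-- Integrals of uniform limits of simple functions.

module IntegralProperties {ℓ} (em : ExcludedMiddle ℓ) (R : CompleteOrderedField ℓ) (S : MeasureSpace R) where
  open CompleteOrderedField R hiding (sum; zero)
  open MeasureSpace S
  open RealProperties em R
  open ComplexProperties em R
  open MeasureProperties em R S
  open PosetReasoning poset
  open Complex R using (ℂ; _+i_; re; im; ofReal; ∣_∣)
  open Simple
  private module C = Complex R

  value-irrelevant : ∀ {P} (h : Fun S P) {x} (x∈P x∈P′ : x ∈ P) → _⟪_⟫ S h x∈P CR.≈ _⟪_⟫ S h x∈P′
  value-irrelevant h {x} x∈P x∈P′ = Func.cong h {x , x∈P} {x , x∈P′} ≡.refl

  ∣ofReal*∣≤ : ∀ {x} z → 0# ≤ x → ∣ ofReal x CR.* z ∣ ≤ x * ∣ z ∣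
  ∣ofReal*∣≤ z 0≤x = ≤.trans (∣z*w∣≤ _ z) (*-monoʳ-≤ (0≤∣∣ z) (∣ofReal∣≤ 0≤x))

  μ-weighted-sum : ∀ {A} (a : A ∈ 𝒜) {n} {B : Fin n → Pred X ℓ} (b : ∀ i → B i ∈ 𝒜) →
    (∀ {i j} → i ≢ j → B i ⊥ B j) → (∀ {x} → x ∈ A → ∃[ i ] x ∈ B i) → ∀ v →
    ofReal (μ a) CR.* v CR.≈ C.sum λ i → ofReal (μ (𝒜-∩ a (b i))) CR.* v
  μ-weighted-sum a b disjoint covers v = CR.trans
    (CR.*-congʳ (CR.trans (ofReal-cong (μ-decompose a b disjoint covers)) (ofReal-sum λ i → μ (𝒜-∩ a (b i)))))
    (ΣC.*-distribʳ-sum v (λ i → ofReal (μ (𝒜-∩ a (b i)))))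

  μ-pieces : ∀ {P} (p : P ∈ 𝒜) (s : Simple S P) → μ p ≈ sum λ k → μ (measurable s k)
  μ-pieces p s = μ-partition p (measurable s) (piece⊆ s) (disjoint s) (covers s)

  -- Both integrals are expanded over the common refinement. Values are compared only where two
  -- pieces meet; on an empty intersection they may be far apart, but its measure is 0.
  ∫-close : ∀ {P} (p : P ∈ 𝒜) (s t : Simple S P) {c} →
    (∀ k l {x} → x ∈ piece s k → x ∈ piece t l → ∣ value s k CR.- value t l ∣ ≤ c) →
    ∣ ∫ s CR.- ∫ t ∣ ≤ c * μ p
  ∫-close {P} p s t {c} close = begin
    ∣ ∫ s CR.- ∫ t ∣
      ≤⟨ ∣∣-reflexive difference ⟩
    ∣ C.sum (λ k → C.sum λ l → d k l) ∣
      ≤⟨ ≤.trans (∣sum∣≤ λ k → C.sum (d k)) (sum-mono-≤ λ k → ≤.trans (∣sum∣≤ (d k)) (sum-mono-≤ (∣d∣≤ k))) ⟩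
    sum (λ k → sum λ l → m k l * c)
      ≈⟨ sum-cong (λ k → trans (*-congʳ (μ-decompose (measurable s k) (measurable t) (disjoint t) (covers t ∘ piece⊆ s k)))
                               (*-distribʳ-sum c (m k))) ⟨
    sum (λ k → μ (measurable s k) * c)
      ≈⟨ *-distribʳ-sum c (λ k → μ (measurable s k)) ⟨
    sum (λ k → μ (measurable s k)) * c
      ≈⟨ trans (*-comm c _) (*-congʳ (μ-pieces p s)) ⟨
    c * μ p
      ∎
    where
    m : Fin (size s) → Fin (size t) → Carrier
    m k l = μ (𝒜-∩ (measurable s k) (measurable t l))

    d : Fin (size s) → Fin (size t) → ℂ
    d k l = ofReal (m k l) CR.* (value s k CR.- value t l)

    ∣d∣≤ : ∀ k l → ∣ d k l ∣ ≤ m k l * c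
    ∣d∣≤ k l with em {∃[ x ] x ∈ piece s k ∩ piece t l}
    ... | yes (_ , x∈Aₖ , x∈Bₗ) =
      ≤.trans (∣ofReal*∣≤ _ (0≤μ _)) (*-monoˡ-≤ (0≤μ _) (close k l x∈Aₖ x∈Bₗ))
    ... | no  empty = begin
      ∣ d k l ∣                                     ≤⟨ ∣ofReal*∣≤ _ (0≤μ _) ⟩
      m k l * ∣ value s k CR.- value t l ∣          ≈⟨ *-congʳ m≈0 ⟩
      0# * ∣ value s k CR.- value t l ∣             ≈⟨ trans (zeroˡ _) (sym (zeroˡ c)) ⟩
      0# * c                                        ≈⟨ *-congʳ m≈0 ⟨
      m k l * c                                     ∎
      where
      m≈0 : m k l ≈ 0#
      m≈0 = μ-∅ _ λ x∈ → empty (_ , x∈)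

    ∫s≈ : ∫ s CR.≈ C.sum λ k → C.sum λ l → ofReal (m k l) CR.* value s k
    ∫s≈ = ΣC.sum-cong-≋ λ k →
      μ-weighted-sum (measurable s k) (measurable t) (disjoint t) (covers t ∘ piece⊆ s k) (value s k)

    ∫t≈ : ∫ t CR.≈ C.sum λ k → C.sum λ l → ofReal (m k l) CR.* value t l
    ∫t≈ = CR.trans
      (ΣC.sum-cong-≋ λ l → CR.trans
        (μ-weighted-sum (measurable t l) (measurable s) (disjoint s) (covers s ∘ piece⊆ t l) (value t l))
        (ΣC.sum-cong-≋ λ k → CR.*-congʳ {value t l} (ofReal-cong (μ-cong
          (𝒜-∩ (measurable t l) (measurable s k)) (𝒜-∩ (measurable s k) (measurable t l)) ((λ (y , z) → z , y) , (λ (y , z) → z , y))))))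
      (ΣC.∑-comm (λ l k → ofReal (m k l) CR.* value t l))

    ∫s≈d+∫t : ∫ s CR.≈ C.sum (λ k → C.sum (d k)) CR.+ ∫ t
    ∫s≈d+∫t = CR.trans ∫s≈ (CR.trans
      (ΣC.sum-cong-≋ λ k → CR.trans
        (ΣC.sum-cong-≋ λ l → solveℂ 3 (λ m v w → m ⊗ v ⊜ m ⊗ (v ⊝ w) ⊕ m ⊗ w) CR.refl (ofReal (m k l)) (value s k) (value t l))
        (ΣC.∑-distrib-+ (d k) (λ l → ofReal (m k l) CR.* value t l)))
      (CR.trans (ΣC.∑-distrib-+ (λ k → C.sum (d k)) (λ k → C.sum λ l → ofReal (m k l) CR.* value t l))
                (CR.+-congˡ (CR.sym ∫t≈))))

    difference : ∫ s CR.- ∫ t CR.≈ C.sum (λ k → C.sum (d k))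
    difference = CR.trans (CR.+-congʳ ∫s≈d+∫t)
      (solveℂ 2 (λ d t → (d ⊕ t) ⊝ t ⊜ d) CR.refl _ (∫ t))

  near-∫-close : ∀ {P} (p : P ∈ 𝒜) {h : Fun S P} (s t : Simple S P) {δ δ′} →
    IsNear s h δ → IsNear t h δ′ → ∣ ∫ s CR.- ∫ t ∣ ≤ (δ + δ′) * μ p
  near-∫-close p {h} s t {δ} {δ′} s-near t-near = ∫-close p s t λ k l {x} x∈Aₖ x∈Bₗ →
    let x∈P = piece⊆ s k x∈Aₖ in begin
    ∣ value s k CR.- value t l ∣
      ≤⟨ ∣x-z∣≤∣x-y∣+∣y-z∣ _ (_⟪_⟫ S h x∈P) _ ⟩
    ∣ value s k CR.- _⟪_⟫ S h x∈P ∣ + ∣ _⟪_⟫ S h x∈P CR.- value t l ∣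
      ≤⟨ +-mono-≤ (≤.trans (∣z-w∣≤∣w-z∣ _ _) (s-near k x∈P x∈Aₖ)) (t-near l x∈P x∈Bₗ) ⟩
    δ + δ′
      ∎

  -- `IsIntegral` offers one good simple function per tolerance; comparison with these at vanishing
  -- tolerance makes every near simple function good. The factor `μ p` lets errors on the pieces of
  -- a decomposition add up to a single error.
  near-integral : ∀ {P} (p : P ∈ 𝒜) {h : Fun S P} {I} → IsIntegral S h I →
    ∀ (s : Simple S P) {δ} → IsNear s h δ → ∣ ∫ s CR.- I ∣ ≤ δ * μ p
  near-integral p {h} {I} I-integral s {δ} s-near =
    ≤-limit (+-nonneg (0≤μ p) 0≤1) λ {δ′} 0<δ′ → let t , t-near , t-close = I-integral 0<δ′ in begin
    ∣ ∫ s CR.- I ∣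
      ≤⟨ ∣x-z∣≤∣x-y∣+∣y-z∣ _ (∫ t) _ ⟩
    ∣ ∫ s CR.- ∫ t ∣ + ∣ ∫ t CR.- I ∣
      ≤⟨ +-mono-≤ (near-∫-close p {h} s t s-near t-near) t-close ⟩
    (δ + δ′) * μ p + δ′
      ≈⟨ solve 3 (λ δ δ′ m → (δ :+ δ′) :* m :+ δ′ := δ :* m :+ δ′ :* (m :+ con (+ 1))) refl δ δ′ (μ p) ⟩
    δ * μ p + δ′ * (μ p + 1#)
      ∎

  constant : ∀ {P} → P ∈ 𝒜 → ℂ → Simple S P
  constant {P} p v = record
    { size       = 1
    ; piece      = λ _ → P
    ; measurable = λ _ → p
    ; piece⊆     = λ _ x∈P → x∈P
    ; disjoint   = λ { {zero} {zero} 0≢0 → contradiction ≡.refl 0≢0 }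
    ; covers     = λ x∈P → zero , x∈P
    ; value      = λ _ → v
    }

  -- A bound c on h says that the constant function 0 is near h with tolerance c.
  ∣integral∣≤ : ∀ {P} (p : P ∈ 𝒜) {h : Fun S P} {I} → IsIntegral S h I →
    ∀ {c} → (∀ {x} (x∈P : x ∈ P) → ∣ _⟪_⟫ S h x∈P ∣ ≤ c) → ∣ I ∣ ≤ c * μ p
  ∣integral∣≤ p {h} {I} I-integral {c} h≤c = begin
    ∣ I ∣                    ≤⟨ ∣∣-reflexive (solveℂ 1 (λ i → i ⊜ i ⊝ conℂ (+ 0)) CR.refl I) ⟩
    ∣ I CR.- CR.0# ∣         ≤⟨ ∣z-w∣≤∣w-z∣ I CR.0# ⟩
    ∣ CR.0# CR.- I ∣         ≤⟨ ∣∣-reflexive (CR.+-congʳ ∫0≈0) ⟩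
    ∣ ∫ 0ₚ CR.- I ∣          ≤⟨ near-integral p {h} I-integral 0ₚ 0-near ⟩
    c * μ p                  ∎
    where
    0ₚ : Simple S _
    0ₚ = constant p CR.0#

    ∫0≈0 : CR.0# CR.≈ ∫ 0ₚ
    ∫0≈0 = CR.sym (CR.trans (CR.+-identityʳ _) (CR.zeroʳ _))

    0-near : IsNear 0ₚ h c
    0-near k x∈P _ = ≤.trans
      (∣∣-reflexive (solveℂ 1 (λ i → i ⊝ conℂ (+ 0) ⊜ i) CR.refl _)) (h≤c x∈P)

  abstract
    -- Since μ ≤ 1, simple functions at tolerances δ and δ′ have integrals at distance at most δ +
    -- δ′. The sharp rate of `cauchy-limitℂ` allows the same simple function to serve for both the
    -- uniform and the integral estimate at δ.
    integral-exists : ∀ {P} → P ∈ 𝒜 → {h : Fun S P} → BoundedMeasurable S h → ∃[ I ] IsIntegral S h I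
    integral-exists p {h} bm = proj₁ limit , λ 0<δ → proj₁ (bm 0<δ) , proj₂ (bm 0<δ) , proj₂ limit 0<δ
      where
      limit : ∃[ L ] ∀ {δ} (p : 0# < δ) → ∣ ∫ (proj₁ (bm p)) CR.- L ∣ ≤ δ
      limit = cauchy-limitℂ (λ _ 0<δ → ∫ (proj₁ (bm 0<δ))) λ {δ} {δ′} 0<δ 0<δ′ → begin
        ∣ ∫ (proj₁ (bm 0<δ)) CR.- ∫ (proj₁ (bm 0<δ′)) ∣
          ≤⟨ near-∫-close p {h} (proj₁ (bm 0<δ)) (proj₁ (bm 0<δ′)) (proj₂ (bm 0<δ)) (proj₂ (bm 0<δ′)) ⟩
        (δ + δ′) * μ p
          ≤⟨ *-monoˡ-≤ (+-nonneg (proj₁ 0<δ) (proj₁ 0<δ′)) (μ≤1 p) ⟩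
        (δ + δ′) * 1#
          ≈⟨ *-identityʳ _ ⟩
        δ + δ′
          ∎

  restrictSimple : ∀ {P Q} → Simple S P → Q ∈ 𝒜 → Q ⊆ P → Simple S Q
  restrictSimple {P} {Q} s q Q⊆P = record
    { size       = size s
    ; piece      = λ k → piece s k ∩ Q
    ; measurable = λ k → 𝒜-∩ (measurable s k) q
    ; piece⊆     = λ _ → proj₂
    ; disjoint   = λ k≢l ((x∈Aₖ , _) , (x∈Aₗ , _)) → disjoint s k≢l (x∈Aₖ , x∈Aₗ)
    ; covers     = λ x∈Q → let k , x∈Aₖ = covers s (Q⊆P x∈Q) in k , x∈Aₖ , x∈Q
    ; value      = value s
    }

  Agree : ∀ {P Q} → Fun S P → Fun S Q → Set ℓ
  Agree {P} {Q} h h′ = ∀ {x} (x∈P : x ∈ P) (x∈Q : x ∈ Q) → _⟪_⟫ S h x∈P CR.≈ _⟪_⟫ S h′ x∈Q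

  restrictSimple-near : ∀ {P Q} {h : Fun S P} {h′ : Fun S Q} → Agree h h′ →
    ∀ (s : Simple S P) (q : Q ∈ 𝒜) (Q⊆P : Q ⊆ P) {δ} → IsNear s h δ → IsNear (restrictSimple s q Q⊆P) h′ δ
  restrictSimple-near agree s q Q⊆P s-near k x∈Q (x∈Aₖ , _) = ≤.trans
    (∣∣-reflexive (CR.+-congʳ (CR.sym (agree (Q⊆P x∈Q) x∈Q)))) (s-near k (Q⊆P x∈Q) x∈Aₖ)

  boundedMeasurable-restrict : ∀ {P Q} {h : Fun S P} {h′ : Fun S Q} → Agree h h′ → Q ∈ 𝒜 → Q ⊆ P →
    BoundedMeasurable S h → BoundedMeasurable S h′
  boundedMeasurable-restrict {h = h} {h′} agree q Q⊆P bm 0<δ = let s , s-near = bm 0<δ in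
    restrictSimple s q Q⊆P , restrictSimple-near {h = h} {h′} agree s q Q⊆P s-near

  -- A single simple function near h is restricted to all pieces: its integrals add up exactly, and
  -- the errors δ μ(B j) sum to δ μ(p). As `I` and `I′` are arbitrary integrals, the case of one
  -- piece contains uniqueness.
  integral-decompose : ∀ {P} (p : P ∈ 𝒜) {n} {B : Fin n → Pred X ℓ} (b : ∀ j → B j ∈ 𝒜) (B⊆P : ∀ j → B j ⊆ P) →
    (∀ {i j} → i ≢ j → B i ⊥ B j) → (∀ {x} → x ∈ P → ∃[ j ] x ∈ B j) →
    {h : Fun S P} {h′ : ∀ j → Fun S (B j)} → (∀ j → Agree h (h′ j)) →
    ∀ {I} {I′ : Fin n → ℂ} → IsIntegral S h I → (∀ j → IsIntegral S (h′ j) (I′ j)) → I CR.≈ C.sum I′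
  integral-decompose {P} p {n} {B} b B⊆P B-disjoint B-covers {h} {h′} agree {I} {I′} I-integral I′-integral =
    ∣z-w∣≤0⇒z≈w (≤-limit (+-nonneg (0≤μ p) (0≤μ p)) λ {δ} 0<δ → bound 0<δ)
    where
    module _ {δ} (0<δ : 0# < δ) where
      s : Simple S P
      s = proj₁ (I-integral 0<δ)

      s-near : IsNear s h δ
      s-near = proj₁ (proj₂ (I-integral 0<δ))

      sⱼ : ∀ j → Simple S (B j)
      sⱼ j = restrictSimple s (b j) (B⊆P j)

      ∫s≈ : ∫ s CR.≈ C.sum λ j → ∫ (sⱼ j)
      ∫s≈ = CR.trans
        (ΣC.sum-cong-≋ λ k →
          μ-weighted-sum (measurable s k) b B-disjoint (B-covers ∘ piece⊆ s k) (value s k))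
        (ΣC.∑-comm λ k j → ofReal (μ (measurable (sⱼ j) k)) CR.* value s k)

      e : Fin n → ℂ
      e j = ∫ (sⱼ j) CR.- I′ j

      ∑∫≈ : C.sum (λ j → ∫ (sⱼ j)) CR.≈ C.sum e CR.+ C.sum I′
      ∑∫≈ = CR.trans
        (ΣC.sum-cong-≋ λ j → solveℂ 2 (λ u v → u ⊜ (u ⊝ v) ⊕ v) CR.refl (∫ (sⱼ j)) (I′ j))
        (ΣC.∑-distrib-+ e I′)

      bound : ∣ I CR.- C.sum I′ ∣ ≤ 0# + δ * (μ p + μ p)
      bound = begin
        ∣ I CR.- C.sum I′ ∣
          ≤⟨ ∣x-z∣≤∣x-y∣+∣y-z∣ I (∫ s) (C.sum I′) ⟩
        ∣ I CR.- ∫ s ∣ + ∣ ∫ s CR.- C.sum I′ ∣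
          ≤⟨ +-mono-≤
               (≤.trans (∣z-w∣≤∣w-z∣ I (∫ s)) (near-integral p {h} I-integral s s-near))
               (≤.trans (∣∣-reflexive (CR.trans (CR.+-congʳ (CR.trans ∫s≈ ∑∫≈))
                          (solveℂ 2 (λ e t → (e ⊕ t) ⊝ t ⊜ e) CR.refl (C.sum e) (C.sum I′))))
                        (∣sum∣≤ e)) ⟩
        δ * μ p + sum (λ j → ∣ e j ∣)
          ≤⟨ +-monoʳ-≤ _ (sum-mono-≤ λ j → near-integral (b j) {h′ j} (I′-integral j) (sⱼ j)
               (restrictSimple-near {h = h} {h′ j} (agree j) s (b j) (B⊆P j) s-near)) ⟩
        δ * μ p + sum (λ j → δ * μ (b j))
          ≈⟨ +-congˡ (trans (*-congˡ (μ-partition p b B⊆P B-disjoint B-covers)) (*-distribˡ-sum δ (λ j → μ (b j)))) ⟨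
        δ * μ p + δ * μ p
          ≈⟨ solve 2 (λ δ m → δ :* m :+ δ :* m := con (+ 0) :+ δ :* (m :+ m)) refl δ (μ p) ⟩
        0# + δ * (μ p + μ p)
          ∎

  -- Here `f` is one number, the value of a witness on a cell. Multiplication by it contracts
  -- distances, so the simple function with transformed values keeps its tolerance δ.
  integral-affine : ∀ {P} (p : P ∈ 𝒜) {h h′ : Fun S P} m {f} → ∣ f ∣ ≤ 1# →
    (∀ {x} (x∈P : x ∈ P) → _⟪_⟫ S h′ x∈P CR.≈ (_⟪_⟫ S h x∈P CR.- m) CR.* f) →
    ∀ {I} → IsIntegral S h I → IsIntegral S h′ ((I CR.- ofReal (μ p) CR.* m) CR.* f)
  integral-affine {P} p {h} {h′} m {f} f≤1 h′≈ {I} I-integral {δ} 0<δ = s′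
    , (λ k x∈P x∈Aₖ → ≤.trans
        (∣∣-reflexive (CR.trans (CR.+-congʳ (h′≈ x∈P)) (solveℂ 4 (λ h m f v → (h ⊝ m) ⊗ f ⊝ (v ⊝ m) ⊗ f ⊜ (h ⊝ v) ⊗ f) CR.refl _ m f (value s k))))
        (contract (s-near k x∈P x∈Aₖ)))
    , ≤.trans
        (∣∣-reflexive (CR.trans (CR.+-congʳ ∫s′≈) (solveℂ 4 (λ s c f i → (s ⊝ c) ⊗ f ⊝ (i ⊝ c) ⊗ f ⊜ (s ⊝ i) ⊗ f) CR.refl (∫ s) _ f I)))
        (contract s-close)
    where
    s : Simple S P
    s = proj₁ (I-integral 0<δ)

    s-near : IsNear s h δ
    s-near = proj₁ (proj₂ (I-integral 0<δ))

    s-close : ∣ ∫ s CR.- I ∣ ≤ δ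
    s-close = proj₂ (proj₂ (I-integral 0<δ))

    contract : ∀ {z} → ∣ z ∣ ≤ δ → ∣ z CR.* f ∣ ≤ δ
    contract {z} z≤δ = ≤.trans (∣z*w∣≤ z f)
      (≤.trans (*-mono-≤ (0≤∣∣ z) 0≤1 z≤δ f≤1) (≤.reflexive (*-identityʳ δ)))

    s′ : Simple S P
    s′ = record
      { size = size s ; piece = piece s ; measurable = measurable s ; piece⊆ = piece⊆ s
      ; disjoint = disjoint s ; covers = covers s
      ; value = λ k → (value s k CR.- m) CR.* f
      }

    ∫s′≈ : ∫ s′ CR.≈ (∫ s CR.- ofReal (μ p) CR.* m) CR.* f
    ∫s′≈ = CR.trans (CR.trans step₁ step₂) step₃
      where
      ν : Fin (size s) → ℂ
      ν k = ofReal (μ (measurable s k))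

      step₁ : ∫ s′ CR.≈ C.sum (λ k → ν k CR.* value s k CR.* f) CR.+ C.sum (λ k → ν k CR.* ((CR.- m) CR.* f))
      step₁ = CR.trans
        (ΣC.sum-cong-≋ λ k → solveℂ 4 (λ a v m f → a ⊗ ((v ⊝ m) ⊗ f) ⊜ a ⊗ v ⊗ f ⊕ a ⊗ ((⊝′ m) ⊗ f))
          CR.refl (ν k) (value s k) m f)
        (ΣC.∑-distrib-+ (λ k → ν k CR.* value s k CR.* f) (λ k → ν k CR.* ((CR.- m) CR.* f)))

      step₂ : C.sum (λ k → ν k CR.* value s k CR.* f) CR.+ C.sum (λ k → ν k CR.* ((CR.- m) CR.* f)) CR.≈
              ∫ s CR.* f CR.+ ofReal (μ p) CR.* ((CR.- m) CR.* f)
      step₂ = CR.sym (CR.+-cong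
        (ΣC.*-distribʳ-sum f (λ k → ν k CR.* value s k))
        (CR.trans (CR.*-congʳ (CR.trans (ofReal-cong (μ-pieces p s)) (ofReal-sum λ k → μ (measurable s k))))
                  (ΣC.*-distribʳ-sum ((CR.- m) CR.* f) ν)))

      step₃ : ∫ s CR.* f CR.+ ofReal (μ p) CR.* ((CR.- m) CR.* f) CR.≈ (∫ s CR.- ofReal (μ p) CR.* m) CR.* f
      step₃ = solveℂ 4 (λ s a m f → s ⊗ f ⊕ a ⊗ ((⊝′ m) ⊗ f) ⊜ (s ⊝ a ⊗ m) ⊗ f) CR.refl (∫ s) (ofReal (μ p)) m f

  -- Taking real parts fixes the values of g and contracts distances, so it can be applied to the
  -- values of the approximating simple functions.
  integral-re : ∀ {P} {g : X → Carrier} {I} →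
    IsIntegral S (restrict S g P) I → IsIntegral S (restrict S g P) (ofReal (re I))
  integral-re {P} {g} {I} I-integral {δ} 0<δ = s′
    , (λ k x∈P x∈Aₖ → re-contract (s-near k x∈P x∈Aₖ))
    , ≤.trans (∣∣-reflexive (CR.+-congʳ ∫s′≈)) (re-contract s-close)
    where
    s : Simple S P
    s = proj₁ (I-integral 0<δ)

    s-near : IsNear s (restrict S g P) δ
    s-near = proj₁ (proj₂ (I-integral 0<δ))

    s-close : ∣ ∫ s CR.- I ∣ ≤ δ
    s-close = proj₂ (proj₂ (I-integral 0<δ))

    re-contract : ∀ {z w} → ∣ z CR.- w ∣ ≤ δ → ∣ ofReal (re z) CR.- ofReal (re w) ∣ ≤ δ
    re-contract {z} {w} z-w≤δ = ≤.trans (∣∣-reflexive (CR.sym (ofReal-- (re z) (re w))))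
      (≤.trans (∣ofReal-re∣≤ (z CR.- w)) z-w≤δ)

    s′ : Simple S P
    s′ = record
      { size = size s ; piece = piece s ; measurable = measurable s ; piece⊆ = piece⊆ s
      ; disjoint = disjoint s ; covers = covers s
      ; value = λ k → ofReal (re (value s k))
      }

    ∫s′≈ : ∫ s′ CR.≈ ofReal (re (∫ s))
    ∫s′≈ = CR.trans
      (ΣC.sum-cong-≋ λ k → CR.trans (CR.sym (ofReal-* _ _)) (ofReal-cong
        (solve 3 (λ a v w → a :* v := a :* v :- con (+ 0) :* w) refl
          (μ (measurable s k)) (re (value s k)) (im (value s k)))))
      (CR.trans (CR.sym (ofReal-sum λ k → re (ofReal (μ (measurable s k)) CR.* value s k)))
        (ofReal-cong (sym (re-sum λ k → ofReal (μ (measurable s k)) CR.* value s k))))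

  -- The common refinement, with pairs of indices coded in one `Fin`. Empty intersections stay as
  -- pieces, which `Simple` permits.
  productSimple : ∀ {P} → (ℂ → ℂ → ℂ) → Simple S P → Simple S P → Simple S P
  productSimple {P} _∙_ s t = record
    { size       = size s ℕ.* size t
    ; piece      = λ k → piece s (fst k) ∩ piece t (snd k)
    ; measurable = λ k → 𝒜-∩ (measurable s (fst k)) (measurable t (snd k))
    ; piece⊆     = λ k (x∈Aₖ , _) → piece⊆ s (fst k) x∈Aₖ
    ; disjoint   = λ {k} {l} k≢l ((x∈Aₖ , x∈Bₖ) , (x∈Aₗ , x∈Bₗ)) →
        k≢l (≡.trans (≡.sym (combine-remQuot {size s} (size t) k)) (≡.trans
          (≡.cong₂ combine (index-unique s x∈Aₖ x∈Aₗ) (index-unique t x∈Bₖ x∈Bₗ))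
          (combine-remQuot {size s} (size t) l)))
    ; covers     = λ {x} x∈P → let k , x∈Aₖ = covers s x∈P; l , x∈Bₗ = covers t x∈P in
        combine k l , ≡.subst (λ (k , l) → x ∈ piece s k ∩ piece t l) (≡.sym (remQuot-combine {size s} {size t} k l)) (x∈Aₖ , x∈Bₗ)
    ; value      = λ k → value s (fst k) ∙ value t (snd k)
    }
    where
    fst : Fin (size s ℕ.* size t) → Fin (size s)
    fst k = proj₁ (remQuot {size s} (size t) k)

    snd : Fin (size s ℕ.* size t) → Fin (size t)
    snd k = proj₂ (remQuot {size s} (size t) k)

    index-unique : ∀ (s : Simple S P) {k l x} → x ∈ piece s k → x ∈ piece s l → k ≡ l
    index-unique s {k} {l} x∈Aₖ x∈Aₗ with k Fin.≟ l
    ... | yes k≡l = k≡l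
    ... | no  k≢l = contradiction (x∈Aₖ , x∈Aₗ) (disjoint s k≢l)

  -- (g − c) f − (v − c) w = (g − v) f + (v − c)(f − w)
  boundedMeasurable-centred : ∀ {P} {g : X → Carrier} → (∀ {x} → x ∈ P → ∣ ofReal (g x) ∣ ≤ 1#) →
    BoundedMeasurable S (restrict S g P) →
    ∀ {f : Fun S P} → BoundedMeasurable S f → (∀ {x} (x∈P : x ∈ P) → ∣ _⟪_⟫ S f x∈P ∣ ≤ 1#) →
    ∀ c → BoundedMeasurable S (centred S g c f)
  boundedMeasurable-centred {P} {g} g≤1 g-bm {f} f-bm f≤1 c {δ} 0<δ =
    productSimple (λ v w → (v CR.- c) CR.* w) s t , λ k {x} x∈P (x∈Aₖ , x∈Bₖ) →
      near x∈P (proj₂ (g-bm 0<η) _ x∈P x∈Aₖ) (proj₂ (f-bm 0<η) _ x∈P x∈Bₖ)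
    where
    -- With tolerance η ≤ 1, the first product is at most η, and the second at most (2 + ∣c∣)η
    -- because ∣v - c∣ ≤ ∣v - g∣ + ∣g∣ + ∣c∣; together this is (3 + ∣c∣)η.
    K : Carrier
    K = 1# + (1# + (1# + ∣ c ∣))

    0≤K : 0# ≤ K
    0≤K = +-nonneg 0≤1 (+-nonneg 0≤1 (+-nonneg 0≤1 (0≤∣∣ c)))

    η : Carrier
    η = shrink δ K

    0<η : 0# < η
    0<η = 0<shrink 0<δ 0≤K

    s t : Simple S P
    s = proj₁ (g-bm 0<η)
    t = proj₁ (f-bm 0<η)

    near : ∀ {x} (x∈P : x ∈ P) {v w} → ∣ ofReal (g x) CR.- v ∣ ≤ η → ∣ _⟪_⟫ S f x∈P CR.- w ∣ ≤ η →
      ∣ (ofReal (g x) CR.- c) CR.* (_⟪_⟫ S f x∈P) CR.- (v CR.- c) CR.* w ∣ ≤ δ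
    near {x} x∈P {v} {w} g-v≤η f-w≤η = begin
      ∣ (gₓ CR.- c) CR.* fₓ CR.- (v CR.- c) CR.* w ∣
        ≤⟨ ∣∣-reflexive (solveℂ 5 (λ g c f v w →
             (g ⊝ c) ⊗ f ⊝ (v ⊝ c) ⊗ w ⊜ (g ⊝ v) ⊗ f ⊕ (v ⊝ c) ⊗ (f ⊝ w)) CR.refl gₓ c fₓ v w) ⟩
      ∣ (gₓ CR.- v) CR.* fₓ CR.+ (v CR.- c) CR.* (fₓ CR.- w) ∣
        ≤⟨ ≤.trans (∣z+w∣≤ _ _) (+-mono-≤ (∣z*w∣≤ _ _) (∣z*w∣≤ _ _)) ⟩
      ∣ gₓ CR.- v ∣ * ∣ fₓ ∣ + ∣ v CR.- c ∣ * ∣ fₓ CR.- w ∣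
        ≤⟨ +-mono-≤ (*-mono-≤ (0≤∣∣ _) 0≤1 g-v≤η (f≤1 x∈P)) (*-mono-≤ (0≤∣∣ _) (proj₁ 0<η) v-c≤ f-w≤η) ⟩
      η * 1# + (1# + (1# + ∣ c ∣)) * η
        ≈⟨ solve 2 (λ η c → η :* con (+ 1) :+ (con (+ 1) :+ (con (+ 1) :+ c)) :* η
                    := η :* (con (+ 1) :+ (con (+ 1) :+ (con (+ 1) :+ c)))) refl η ∣ c ∣ ⟩
      η * K
        ≤⟨ shrink-≤ (proj₁ 0<δ) 0≤K ⟩
      δ
        ∎
      where
      gₓ fₓ : ℂ
      gₓ = ofReal (g x)
      fₓ = _⟪_⟫ S f x∈P

      v-c≤ : ∣ v CR.- c ∣ ≤ 1# + (1# + ∣ c ∣)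
      v-c≤ = begin
        ∣ v CR.- c ∣
          ≤⟨ ∣x-z∣≤∣x-y∣+∣y-z∣ v gₓ c ⟩
        ∣ v CR.- gₓ ∣ + ∣ gₓ CR.- c ∣
          ≤⟨ +-mono-≤ (≤.trans (∣z-w∣≤∣w-z∣ v gₓ) (≤.trans g-v≤η (shrink≤1 (proj₁ 0<δ) 0≤K))) (∣z-w∣≤ gₓ c) ⟩
        1# + (∣ gₓ ∣ + ∣ c ∣)
          ≤⟨ +-monoʳ-≤ 1# (+-mono-≤ (g≤1 x∈P) ≤.refl) ⟩
        1# + (1# + ∣ c ∣)
          ∎

-- The energy increment as an inequality for matrices.

module EnergyIncrement {ℓ} (em : ExcludedMiddle ℓ) (R : CompleteOrderedField ℓ) where
  open CompleteOrderedField R hiding (sum; zero)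
  open RealProperties em R

  ∑∑ : ∀ {m n} → (Fin m → Fin n → Carrier) → Carrier
  ∑∑ f = sum λ i → sum λ j → f i j

  ∑∑-cong : ∀ {m n} {f g : Fin m → Fin n → Carrier} → (∀ i j → f i j ≈ g i j) → ∑∑ f ≈ ∑∑ g
  ∑∑-cong f≈g = sum-cong λ i → sum-cong (f≈g i)

  ∑∑-distrib-+ : ∀ {m n} (f g : Fin m → Fin n → Carrier) → ∑∑ (λ i j → f i j + g i j) ≈ ∑∑ f + ∑∑ g
  ∑∑-distrib-+ f g = trans (sum-cong λ i → ∑-distrib-+ (f i) (g i)) (∑-distrib-+ (λ i → sum (f i)) (λ i → sum (g i)))

  -- M is the matrix of measures of the cells P_i ∩ Q_j, and u and v are the averages over P_i and Q_j.
  -- Summing 0 ≤ M (∣v − u∣ − ε)² replaces the Cauchy–Schwarz inequality.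
  energy-increment : ∀ {m n} (M a : Fin m → Fin n → Carrier) (p u : Fin m → Carrier) (r v : Fin n → Carrier) {ε} →
    (∀ i j → 0# ≤ M i j) → (∀ i → p i ≈ sum (M i)) → (∀ j → r j ≈ sum λ i → M i j) → sum p ≈ 1# →
    (∀ i → sum (λ j → M i j * v j) ≈ p i * u i) →
    (∀ i j → a i j * a i j ≈ (v j - u i) * (v j - u i)) →
    0# ≤ ε → ε ≤ ∑∑ (λ i j → M i j * a i j) →
    sum (λ i → p i * (u i * u i)) + ε * ε ≤ sum (λ j → r j * (v j * v j))
  energy-increment {m} {n} M a p u r v {ε} 0≤M p≈ r≈ ∑p≈1 ∑Mv≈pu a²≈ 0≤ε ε≤T =
    -- With N = Σ M(a - ε)² and Σ Ma² = q′ - q, expansion gives q′ - q - ε² = N + 2ε(T - ε), a sum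
    -- of nonnegative terms.
    ≤-from (+-nonneg 0≤N (*-nonneg (+-nonneg 0≤ε 0≤ε) (x≤y⇒0≤y-x ε≤T)))
      (trans (solve 4 (λ N q ε T → N :+ (ε :+ ε) :* (T :- ε)
                := (N :+ ((q :+ q) :+ (ε :+ ε) :* T)) :- (q :+ ε :* ε) :- (q :+ ε :* ε)) refl (∑∑ N) q ε T)
        (trans (+-congʳ (+-congʳ balance))
          (solve 3 (λ q′ q e → (q′ :+ (q :+ e)) :- (q :+ e) :- (q :+ e) := q′ :- (q :+ e)) refl q′ q (ε * ε))))
    where
    q q′ T : Carrier
    q  = sum λ i → p i * (u i * u i)
    q′ = sum λ j → r j * (v j * v j)
    T  = ∑∑ λ i j → M i j * a i j

    N Y Z V W E : Fin m → Fin n → Carrier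
    N i j = M i j * ((a i j - ε) * (a i j - ε))
    Y i j = M i j * v j * (u i + u i)
    Z i j = (ε + ε) * (M i j * a i j)
    V i j = M i j * (v j * v j)
    W i j = M i j * (u i * u i)
    E i j = M i j * (ε * ε)

    0≤N : 0# ≤ ∑∑ N
    0≤N = sum-nonneg λ i → sum-nonneg λ j → *-nonneg (0≤M i j) (x*x-nonneg _)

    -- The square M(a - ε)², with a² replaced by (v - u)², is expanded and its negative terms are
    -- moved across, so that each side is a plain sum to which linearity applies. `Y` is the cross
    -- term 2Muv.
    expand : ∀ i j → N i j + (Y i j + Z i j) ≈ V i j + (W i j + E i j)
    expand i j = trans
      (solve 5 (λ m a ε v u → m :* ((a :- ε) :* (a :- ε)) :+ (m :* v :* (u :+ u) :+ (ε :+ ε) :* (m :* a))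
                  := m :* (a :* a) :+ (m :* (ε :* ε) :+ m :* v :* (u :+ u))) refl (M i j) (a i j) ε (v j) (u i))
      (trans (+-congʳ (*-congˡ (a²≈ i j)))
        (solve 4 (λ m ε v u → m :* ((v :- u) :* (v :- u)) :+ (m :* (ε :* ε) :+ m :* v :* (u :+ u))
                    := m :* (v :* v) :+ (m :* (u :* u) :+ m :* (ε :* ε))) refl (M i j) ε (v j) (u i)))

    ∑∑Y≈ : ∑∑ Y ≈ q + q
    ∑∑Y≈ = trans
      (sum-cong λ i → trans (sym (*-distribʳ-sum (u i + u i) (λ j → M i j * v j)))
        (trans (*-congʳ (∑Mv≈pu i))
          (solve 2 (λ p u → p :* u :* (u :+ u) := p :* (u :* u) :+ p :* (u :* u)) refl (p i) (u i))))
      (∑-distrib-+ (λ i → p i * (u i * u i)) (λ i → p i * (u i * u i)))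

    ∑∑Z≈ : ∑∑ Z ≈ (ε + ε) * T
    ∑∑Z≈ = sym (trans (*-distribˡ-sum (ε + ε) (λ i → sum λ j → M i j * a i j))
      (sum-cong λ i → *-distribˡ-sum (ε + ε) (λ j → M i j * a i j)))

    ∑∑V≈ : ∑∑ V ≈ q′
    ∑∑V≈ = trans (∑-comm V) (sum-cong λ j →
      sym (trans (*-congʳ (r≈ j)) (*-distribʳ-sum (v j * v j) (λ i → M i j))))

    ∑∑W≈ : ∑∑ W ≈ q
    ∑∑W≈ = sum-cong λ i → sym (trans (*-congʳ (p≈ i)) (*-distribʳ-sum (u i * u i) (M i)))

    ∑∑E≈ : ∑∑ E ≈ ε * ε
    ∑∑E≈ = trans
      (sum-cong λ i → sym (trans (*-congʳ (p≈ i)) (*-distribʳ-sum (ε * ε) (M i))))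
      (trans (sym (*-distribʳ-sum (ε * ε) p)) (trans (*-congʳ ∑p≈1) (*-identityˡ _)))

    balance : ∑∑ N + ((q + q) + (ε + ε) * T) ≈ q′ + (q + ε * ε)
    balance = trans
      (sym (trans (∑∑-distrib-+ N (λ i j → Y i j + Z i j)) (+-congˡ (trans (∑∑-distrib-+ Y Z) (+-cong ∑∑Y≈ ∑∑Z≈)))))
      (trans (∑∑-cong expand)
        (trans (∑∑-distrib-+ V (λ i j → W i j + E i j)) (+-cong ∑∑V≈ (trans (∑∑-distrib-+ W E) (+-cong ∑∑W≈ ∑∑E≈)))))

-- The integral of g as a set function, and its averages.

module Regularity {ℓ} (em : ExcludedMiddle ℓ) (R : CompleteOrderedField ℓ) (S : MeasureSpace R)
  (g : MeasureSpace.X S → CompleteOrderedField.Carrier R)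
  (0≤g≤1 : ∀ x → CompleteOrderedField._≤_ R (CompleteOrderedField.0# R) (g x) ×
                 CompleteOrderedField._≤_ R (g x) (CompleteOrderedField.1# R))
  (g-bm : BoundedMeasurable S (restrict S g U)) where
  open CompleteOrderedField R hiding (sum; zero)
  open MeasureSpace S
  open RealProperties em R
  open ComplexProperties em R
  open MeasureProperties em R S
  open IntegralProperties em R S
  open EnergyIncrement em R
  open PosetReasoning poset
  open Complex R using (ℂ; re; ofReal; ∣_∣)
  open Partition
  private module C = Complex R

  ∣g∣≤1 : ∀ x → ∣ ofReal (g x) ∣ ≤ 1#
  ∣g∣≤1 x = ≤.trans (∣ofReal∣≤ (proj₁ (0≤g≤1 x))) (proj₂ (0≤g≤1 x))

  g-boundedMeasurable : ∀ {A} → A ∈ 𝒜 → BoundedMeasurable S (restrict S g A)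
  g-boundedMeasurable {A} a =
    boundedMeasurable-restrict {h = restrict S g U} {restrict S g A} (λ _ _ → CR.refl) a (λ _ → tt) g-bm

  abstract
    real-integral : ∀ {A} → A ∈ 𝒜 → ∃[ x ] IsIntegral S (restrict S g A) (ofReal x)
    real-integral {A} a = let I , I-integral = integral-exists a {restrict S g A} (g-boundedMeasurable a) in
      re I , integral-re {A} {g} {I} I-integral

  -- The set function A ↦ ∫_A g, finitely additive and dominated by μ.
  γ : ∀ {A} → A ∈ 𝒜 → Carrier
  γ a = proj₁ (real-integral a)

  γ-integral : ∀ {A} (a : A ∈ 𝒜) → IsIntegral S (restrict S g A) (ofReal (γ a))
  γ-integral a = proj₂ (real-integral a)

  γ-decompose : ∀ {A} (a : A ∈ 𝒜) {n} {B : Fin n → Pred X ℓ} (b : ∀ j → B j ∈ 𝒜) → (∀ j → B j ⊆ A) →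
    (∀ {i j} → i ≢ j → B i ⊥ B j) → (∀ {x} → x ∈ A → ∃[ j ] x ∈ B j) →
    γ a ≈ sum λ j → γ (b j)
  γ-decompose {A} a {B = B} b B⊆A B-disjoint B-covers = trans
    (proj₁ (integral-decompose a b B⊆A B-disjoint B-covers {restrict S g A} {λ j → restrict S g (B j)}
      (λ _ _ _ → CR.refl) (γ-integral a) (λ j → γ-integral (b j))))
    (re-sum λ j → ofReal (γ (b j)))

  -- Decomposition of A into the single piece B. This is not automatic: `γ` takes a membership
  -- proof, and the integral picked may vary with it.
  γ-cong : ∀ {A B} (a : A ∈ 𝒜) (b : B ∈ 𝒜) → A ≐ B → γ a ≈ γ b
  γ-cong {A} {B} a b (A⊆B , B⊆A) = trans
    (γ-decompose a {1} {λ _ → B} (λ _ → b) (λ _ → B⊆A)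
      (λ { {zero} {zero} 0≢0 → contradiction ≡.refl 0≢0 }) (λ x∈A → zero , A⊆B x∈A))
    (+-identityʳ (γ b))

  ∣γ∣≤μ : ∀ {A} (a : A ∈ 𝒜) → ∣ ofReal (γ a) ∣ ≤ μ a
  ∣γ∣≤μ {A} a = ≤.trans
    (∣integral∣≤ a {restrict S g A} (γ-integral a) λ {x} _ → ∣g∣≤1 x) (≤.reflexive (*-identityˡ (μ a)))

  -- Decomposition into no pieces at all.
  γ-∅ : ∀ {A} (a : A ∈ 𝒜) → (∀ {x} → x ∉ A) → γ a ≈ 0#
  γ-∅ {A} a empty = γ-decompose a {0} {λ ()} (λ ()) (λ ()) (λ { {()} }) (λ x∈A → contradiction x∈A empty)

  average : ∀ {A} → A ∈ 𝒜 → Carrier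
  average a = μ a ⁻¹ * γ a

  μ*μ⁻¹* : ∀ {A} (a : A ∈ 𝒜) → 0# < μ a → ∀ x → μ a * (μ a ⁻¹ * x) ≈ x
  μ*μ⁻¹* a 0<μ x = trans (sym (*-assoc _ _ x)) (trans (*-congʳ (0<x⇒x*x⁻¹≈1 0<μ)) (*-identityˡ x))

  average² : ∀ {A} (a : A ∈ 𝒜) → 0# < μ a → average a * average a ≤ 1#
  average² a 0<μ = begin
    μ a ⁻¹ * γ a * (μ a ⁻¹ * γ a)
      ≈⟨ solve 2 (λ i c → i :* c :* (i :* c) := i :* i :* (c :* c)) refl (μ a ⁻¹) (γ a) ⟩
    μ a ⁻¹ * μ a ⁻¹ * (γ a * γ a)
      ≈⟨ *-congˡ (∣ofReal∣*∣ofReal∣ (γ a)) ⟨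
    μ a ⁻¹ * μ a ⁻¹ * (∣ ofReal (γ a) ∣ * ∣ ofReal (γ a) ∣)
      ≤⟨ *-monoˡ-≤ (x*x-nonneg _) (*-mono-≤ (0≤∣∣ _) (0≤μ a) (∣γ∣≤μ a) (∣γ∣≤μ a)) ⟩
    μ a ⁻¹ * μ a ⁻¹ * (μ a * μ a)
      ≈⟨ solve 2 (λ i m → i :* i :* (m :* m) := m :* i :* (m :* i)) refl (μ a ⁻¹) (μ a) ⟩
    μ a * μ a ⁻¹ * (μ a * μ a ⁻¹)
      ≈⟨ *-cong (0<x⇒x*x⁻¹≈1 0<μ) (0<x⇒x*x⁻¹≈1 0<μ) ⟩
    1# * 1#
      ≈⟨ *-identityˡ 1# ⟩
    1#
      ∎

  -- Averages over the parts and the energy of a partition.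

  module Parts (𝒫 : Partition S) where
    p : ∀ i → part 𝒫 i ∈ 𝒜
    p = measurable 𝒫

    ∑μ≈1 : sum (λ i → μ (p i)) ≈ 1#
    ∑μ≈1 = trans (sym (μ-partition 𝒜-U p (λ _ _ → tt) (disjoint 𝒫) (λ {x} _ → covers 𝒫 x))) μ-U

    u : Fin (size 𝒫) → Carrier
    u i = average (p i)

    centredAt : ∀ i → Fun S (part 𝒫 i) → Fun S (part 𝒫 i)
    centredAt i = centred S g (ofReal (u i))

  energy : Partition S → Carrier
  energy 𝒫 = sum λ i → μ (p i) * (u i * u i)
    where open Parts 𝒫

  0≤energy : ∀ 𝒫 → 0# ≤ energy 𝒫
  0≤energy 𝒫 = sum-nonneg λ i → *-nonneg (0≤μ (p i)) (x*x-nonneg (u i))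
    where open Parts 𝒫

  energy≤1 : ∀ 𝒫 → energy 𝒫 ≤ 1#
  energy≤1 𝒫 = begin
    sum (λ i → μ (p i) * (u i * u i))
      ≤⟨ sum-mono-≤ (λ i → *-monoˡ-≤ (0≤μ (p i)) (average² (p i) (positive 𝒫 i))) ⟩
    sum (λ i → μ (p i) * 1#)
      ≈⟨ sum-cong (λ i → *-identityʳ (μ (p i))) ⟩
    sum (λ i → μ (p i))
      ≈⟨ ∑μ≈1 ⟩
    1#
      ∎
    where open Parts 𝒫

  -- The empty sum is 0, while the measures of the parts sum to 1.
  0<size : ∀ 𝒫 → 0 ℕ.< size 𝒫
  0<size 𝒫 = positive-length (Parts.∑μ≈1 𝒫)
    where
    positive-length : ∀ {n} {f : Fin n → Carrier} → sum f ≈ 1# → 0 ℕ.< n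
    positive-length {zero}  0≈1 = contradiction 0≈1 0≉1
    positive-length {suc n} _   = ℕ.s≤s ℕ.z≤n

  constantFun : ∀ {P} → ℂ → Fun S P
  constantFun v = record { to = λ _ → v ; cong = λ _ → CR.refl }

  -- A partition, a refinement of it, and their cells.

  module Refinement (𝒫 𝒬 : Partition S) (refines : _Refines_ S 𝒬 𝒫) where
    open Parts 𝒫
    open Parts 𝒬 using () renaming (p to q; u to v)

    cell : ∀ i j → (part 𝒫 i ∩ part 𝒬 j) ∈ 𝒜
    cell i j = 𝒜-∩ (p i) (q j)

    M a : Fin (size 𝒫) → Fin (size 𝒬) → Carrier
    M i j = μ (cell i j)
    a i j = ∣ ofReal (v j - u i) ∣

    -- Q_j lies in some P_i′ by refinement; a point shared with P_i forces i′ = i by disjointness.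
    nonempty-cell⇒⊆ : ∀ {i j x} → x ∈ part 𝒫 i → x ∈ part 𝒬 j → part 𝒬 j ⊆ part 𝒫 i
    nonempty-cell⇒⊆ {i} {j} x∈P x∈Q with refines j
    ... | i′ , Q⊆P′ with i′ Fin.≟ i
    ...   | yes ≡.refl = Q⊆P′
    ...   | no  i′≢i   = contradiction (Q⊆P′ x∈Q , x∈P) (disjoint 𝒫 i′≢i)

    -- A nonempty cell is all of Q_j, where measure times average is the integral; on an empty cell
    -- both sides vanish. The average over Q_j thus serves as the average over every cell.
    M*v≈γ : ∀ i j → M i j * v j ≈ γ (cell i j)
    M*v≈γ i j with em {∃[ x ] x ∈ part 𝒫 i ∩ part 𝒬 j}
    ... | yes (_ , x∈P , x∈Q) = trans
      (*-congʳ (μ-cong (cell i j) (q j) P∩Q≐Q))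
      (trans (μ*μ⁻¹* (q j) (positive 𝒬 j) (γ (q j))) (sym (γ-cong (cell i j) (q j) P∩Q≐Q)))
      where
      P∩Q≐Q : part 𝒫 i ∩ part 𝒬 j ≐ part 𝒬 j
      P∩Q≐Q = proj₂ , λ y∈Q → nonempty-cell⇒⊆ x∈P x∈Q y∈Q , y∈Q
    ... | no  empty = trans
      (trans (*-congʳ (μ-∅ (cell i j) (λ x∈ → empty (_ , x∈)))) (zeroˡ (v j)))
      (sym (γ-∅ (cell i j) (λ x∈ → empty (_ , x∈))))

    cells-disjoint : ∀ i {j k} → j ≢ k → (part 𝒫 i ∩ part 𝒬 j) ⊥ (part 𝒫 i ∩ part 𝒬 k)
    cells-disjoint i j≢k ((_ , x∈Q) , (_ , x∈Q′)) = disjoint 𝒬 j≢k (x∈Q , x∈Q′)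

    cells-cover : ∀ i {x} → x ∈ part 𝒫 i → ∃[ j ] x ∈ part 𝒫 i ∩ part 𝒬 j
    cells-cover i {x} x∈P = let j , x∈Q = covers 𝒬 x in j , x∈P , x∈Q

    ∑Mv≈μu : ∀ i → sum (λ j → M i j * v j) ≈ μ (p i) * u i
    ∑Mv≈μu i = trans (sum-cong (M*v≈γ i)) (trans
      (sym (γ-decompose (p i) (cell i) (λ _ → proj₁) (cells-disjoint i) (cells-cover i)))
      (sym (μ*μ⁻¹* (p i) (positive 𝒫 i) (γ (p i)))))

    energy-increases : ∀ {ε} → 0# ≤ ε → ε ≤ ∑∑ (λ i j → M i j * a i j) → energy 𝒫 + ε * ε ≤ energy 𝒬
    energy-increases = energy-increment M a (λ i → μ (p i)) u (λ j → μ (q j)) v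
      (λ i j → 0≤μ (cell i j))
      (λ i → μ-decompose (p i) q (disjoint 𝒬) (λ {x} _ → covers 𝒬 x))
      (λ j → trans (μ-decompose (q j) p (disjoint 𝒫) (λ {x} _ → covers 𝒫 x))
        (sum-cong λ i → μ-cong (𝒜-∩ (q j) (p i)) (cell i j) ((λ (y , z) → z , y) , (λ (y , z) → z , y))))
      ∑μ≈1 ∑Mv≈μu (λ i j → ∣ofReal∣*∣ofReal∣ (v j - u i))

    module _ i (f : Fun S (part 𝒫 i)) (f≤1 : ∀ {x} (x∈P : x ∈ part 𝒫 i) → ∣ _⟪_⟫ S f x∈P ∣ ≤ 1#)
      (f-constant : ∀ j (Q⊆P : part 𝒬 j ⊆ part 𝒫 i) {x y} (x∈Q : x ∈ part 𝒬 j) (y∈Q : y ∈ part 𝒬 j) →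
        _⟪_⟫ S f (Q⊆P x∈Q) CR.≈ _⟪_⟫ S f (Q⊆P y∈Q)) where

      private
        value-on-cell : ∀ j → ∃[ w ] ∣ w ∣ ≤ 1# ×
          (∀ {x} (x∈P : x ∈ part 𝒫 i) → x ∈ part 𝒬 j → _⟪_⟫ S f x∈P CR.≈ w)
        value-on-cell j with em {∃[ x ] x ∈ part 𝒫 i ∩ part 𝒬 j}
        ... | yes (y , y∈P , y∈Q) = _⟪_⟫ S f y∈P , f≤1 y∈P , λ x∈P x∈Q →
          CR.trans (value-irrelevant f x∈P _)
            (CR.trans (f-constant j (nonempty-cell⇒⊆ y∈P y∈Q) x∈Q y∈Q) (value-irrelevant f _ y∈P))
        -- A default for empty cells: no point tests it, and its modulus is still at most 1.
        ... | no  empty = CR.0# , ≤.trans ∣0∣≤0 0≤1 , λ x∈P x∈Q → contradiction (_ , x∈P , x∈Q) empty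

        w : ∀ j → ℂ
        w j = proj₁ (value-on-cell j)

      -- On a cell f is a constant w, so the cell contributes M(v - u)w. As ∣w∣ ≤ 1, the witness
      -- disappears from the bound and only the change of the average of g remains.
      ∣integral-centred∣≤ : ∀ {I} → IsIntegral S (centredAt i f) I → ∣ I ∣ ≤ sum λ j → M i j * a i j
      ∣integral-centred∣≤ {I} I-integral = begin
        ∣ I ∣
          ≤⟨ ∣∣-reflexive (integral-decompose (p i) (cell i) (λ _ → proj₁) (cells-disjoint i) (cells-cover i)
               {centredAt i f} {λ j → h j}
               (λ j x∈P x∈ → CR.*-congˡ (proj₂ (proj₂ (value-on-cell j)) x∈P (proj₂ x∈)))
               I-integral
               (λ j → integral-affine (cell i j) {restrict S g _} {h j} (ofReal (u i)) (proj₁ (proj₂ (value-on-cell j)))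
                        (λ _ → CR.refl) (γ-integral (cell i j)))) ⟩
        ∣ C.sum (λ j → c j CR.* w j) ∣
          ≤⟨ ≤.trans (∣sum∣≤ λ j → c j CR.* w j) (sum-mono-≤ bound) ⟩
        sum (λ j → M i j * a i j)
          ∎
        where
        h : ∀ j → Fun S (part 𝒫 i ∩ part 𝒬 j)
        h j = centred S g (ofReal (u i)) (constantFun (w j))

        c : Fin (size 𝒬) → ℂ
        c j = ofReal (γ (cell i j)) CR.- ofReal (M i j) CR.* ofReal (u i)

        c≈ : ∀ j → c j CR.≈ ofReal (M i j) CR.* ofReal (v j - u i)
        c≈ j = CR.trans
          (CR.+-cong
            (CR.trans (ofReal-cong (sym (M*v≈γ i j))) (ofReal-* (M i j) (v j)))
            CR.refl)
          (CR.trans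
            (solveℂ 3 (λ m v u → m ⊗ v ⊝ m ⊗ u ⊜ m ⊗ (v ⊝ u)) CR.refl (ofReal (M i j)) (ofReal (v j)) (ofReal (u i)))
            (CR.*-congˡ (CR.sym (ofReal-- (v j) (u i)))))

        bound : ∀ j → ∣ c j CR.* w j ∣ ≤ M i j * a i j
        bound j = begin
          ∣ c j CR.* w j ∣              ≤⟨ ∣z*w∣≤ (c j) (w j) ⟩
          ∣ c j ∣ * ∣ w j ∣             ≤⟨ *-monoˡ-≤ (0≤∣∣ (c j)) (proj₁ (proj₂ (value-on-cell j))) ⟩
          ∣ c j ∣ * 1#                  ≈⟨ *-identityʳ ∣ c j ∣ ⟩
          ∣ c j ∣                       ≤⟨ ∣∣-reflexive (c≈ j) ⟩
          ∣ ofReal (M i j) CR.* ofReal (v j - u i) ∣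
                                        ≤⟨ ∣ofReal*∣≤ _ (0≤μ (cell i j)) ⟩
          M i j * a i j                 ∎

  -- Regularity, or witnesses with large total correlation.

  module Dichotomy (𝓕 : Families S)
    (𝓕-witness : ∀ (𝒫 : Partition S) i → IsWitnessFamily S (part 𝒫 i) (𝓕 (part 𝒫 i)))
    (𝒫 : Partition S) where
    open Parts 𝒫
    private module W i = IsWitnessFamily (𝓕-witness 𝒫 i)

    abstract
      integral : ∀ i {f} → f ∈ 𝓕 (part 𝒫 i) → ∃[ I ] IsIntegral S (centredAt i f) I
      integral i {f} f∈𝓕 = integral-exists (p i) {centredAt i f}
        (boundedMeasurable-centred {g = g} (λ {x} _ → ∣g∣≤1 x) (g-boundedMeasurable (p i))
          {f} (W.measurable i f∈𝓕) (W.norm≤1 i f∈𝓕) (ofReal (u i)))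

    correlation : ∀ i {f} → f ∈ 𝓕 (part 𝒫 i) → ℂ
    correlation i f∈𝓕 = ofReal (μ (p i) ⁻¹) CR.* proj₁ (integral i f∈𝓕)

    Correlations : ∀ i → Pred Carrier ℓ
    Correlations i v = ∃[ f ] Σ (f ∈ 𝓕 (part 𝒫 i)) λ f∈𝓕 → v ≈ ∣ correlation i f∈𝓕 ∣

    ∣correlation∣≤ : ∀ i {f} (f∈𝓕 : f ∈ 𝓕 (part 𝒫 i)) →
      ∣ correlation i f∈𝓕 ∣ ≤ μ (p i) ⁻¹ * ∣ proj₁ (integral i f∈𝓕) ∣
    ∣correlation∣≤ i f∈𝓕 = ∣ofReal*∣≤ {μ (p i) ⁻¹} (proj₁ (integral i f∈𝓕)) (0<x⇒0≤x⁻¹ (positive 𝒫 i))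

    ∣centred∣≤ : ∀ i {f} → f ∈ 𝓕 (part 𝒫 i) → ∀ {x} (x∈P : x ∈ part 𝒫 i) →
      ∣ _⟪_⟫ S (centredAt i f) x∈P ∣ ≤ 1# + ∣ ofReal (u i) ∣
    ∣centred∣≤ i {f} f∈𝓕 {x} x∈P = begin
      ∣ (ofReal (g x) CR.- ofReal (u i)) CR.* (_⟪_⟫ S f x∈P) ∣
        ≤⟨ ∣z*w∣≤ (ofReal (g x) CR.- ofReal (u i)) (_⟪_⟫ S f x∈P) ⟩
      ∣ ofReal (g x) CR.- ofReal (u i) ∣ * ∣ _⟪_⟫ S f x∈P ∣
        ≤⟨ *-mono-≤ (0≤∣∣ (ofReal (g x) CR.- ofReal (u i))) 0≤1
             (≤.trans (∣z-w∣≤ (ofReal (g x)) (ofReal (u i))) (+-mono-≤ (∣g∣≤1 x) ≤.refl)) (W.norm≤1 i f∈𝓕 x∈P) ⟩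
      (1# + ∣ ofReal (u i) ∣) * 1#
        ≈⟨ *-identityʳ _ ⟩
      1# + ∣ ofReal (u i) ∣
        ∎

    -- A crude finite bound; its purpose is to let completeness supply the supremum.
    bound : ∀ i → Carrier
    bound i = μ (p i) ⁻¹ * ((1# + ∣ ofReal (u i) ∣) * μ (p i))

    ∣correlation∣≤bound : ∀ i {f} (f∈𝓕 : f ∈ 𝓕 (part 𝒫 i)) → ∣ correlation i f∈𝓕 ∣ ≤ bound i
    ∣correlation∣≤bound i {f} f∈𝓕 = ≤.trans (∣correlation∣≤ i f∈𝓕)
      (*-monoˡ-≤ {μ (p i) ⁻¹} (0<x⇒0≤x⁻¹ (positive 𝒫 i))
        (∣integral∣≤ (p i) {centredAt i f} {proj₁ (integral i f∈𝓕)} (proj₂ (integral i f∈𝓕)) (∣centred∣≤ i f∈𝓕)))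

    abstract
      supremum : ∀ i → ∃[ s ] IsSupremum (Correlations i) s
      supremum i = complete (Correlations i)
        (∣ correlation i (proj₂ (W.nonempty i)) ∣ , proj₁ (W.nonempty i) , proj₂ (W.nonempty i) , refl)
        (bound i , λ { {v} (f , f∈𝓕 , v≈) → ≤.trans (≤.reflexive v≈) (∣correlation∣≤bound i f∈𝓕) })

    sup : Fin (size 𝒫) → Carrier
    sup i = proj₁ (supremum i)

    -- If every correlation stayed below sup - η, that number would be a smaller upper bound.
    -- Excluded middle turns this contradiction into an actual witness.
    approximate : ∀ i {η} → 0# < η → ∃[ f ] Σ (f ∈ 𝓕 (part 𝒫 i)) λ f∈𝓕 → sup i ≤ ∣ correlation i f∈𝓕 ∣ + η
    approximate i {η} 0<η with em {∃[ f ] Σ (f ∈ 𝓕 (part 𝒫 i)) λ f∈𝓕 → sup i ≤ ∣ correlation i f∈𝓕 ∣ + η}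
    ... | yes found = found
    ... | no  none  = contradiction η≤0 (<⇒≱ 0<η)
      where
      η≤0 : η ≤ 0#
      η≤0 = ≤-from
        (x≤y⇒0≤y-x (proj₂ (proj₂ (supremum i)) {sup i - η} λ { {v} (f , f∈𝓕 , v≈) →
          ≤-from (x≤y⇒0≤y-x (≰⇒≥ λ sup≤ → none (f , f∈𝓕 , sup≤)))
            (trans (solve 3 (λ s c η → s :- (c :+ η) := (s :- η) :- c) refl (sup i) ∣ correlation i f∈𝓕 ∣ η)
                   (+-congˡ (-‿cong (sym v≈)))) }))
        (solve 2 (λ s η → s :- η :- s := con (+ 0) :- η) refl (sup i) η)

    regular : ∀ {ε} → sum (λ i → μ (p i) * sup i) ≤ ε → IsRegular S 𝓕 g ε 𝒫
    regular ∑≤ε = record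
      { mean                    = λ i → ofReal (u i)
      ; mean-expectation        = λ i → ofReal (γ (p i)) , γ-integral (p i) , ofReal-* (μ (p i) ⁻¹) (γ (p i))
      ; correlation             = λ i → correlation i
      ; correlation-expectation = λ i f∈𝓕 → proj₁ (integral i f∈𝓕) , proj₂ (integral i f∈𝓕) , CR.refl
      ; sup                     = sup
      ; sup-isSupremum          = λ i → proj₂ (supremum i)
      ; inequality              = ∑≤ε
      }

    -- This is the weighted sum of the correlations Σ μ(P) ∣E_P[(g - E_P g) f_P]∣: the weight μ(P)
    -- cancels the normalization of the expectation.
    ∑∣integral∣ : Witnesses S 𝓕 𝒫 → Carrier
    ∑∣integral∣ w = sum λ i → ∣ proj₁ (integral i (proj₂ (w i))) ∣

    correlated : ∀ {ε} → ¬ sum (λ i → μ (p i) * sup i) ≤ ε → ∃[ w ] ε ≤ ∑∣integral∣ w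
    correlated {ε} ∑≰ε = (λ i → proj₁ (best i) , proj₁ (proj₂ (best i))) , ≤-from (x≤y⇒0≤y-x ∑≤)
        (solve 3 (λ I s ε → I :+ (s :- ε) :- s := I :- ε) refl ∑I ∑sup ε)
      where
      ∑sup : Carrier
      ∑sup = sum λ i → μ (p i) * sup i

      -- The whole surplus over ε is allowed as an error in every part: the weights μ(P) sum to 1,
      -- so the total loss is η and exactly ε remains.
      η : Carrier
      η = ∑sup - ε

      best : ∀ i → ∃[ f ] Σ (f ∈ 𝓕 (part 𝒫 i)) λ f∈𝓕 → sup i ≤ ∣ correlation i f∈𝓕 ∣ + η
      best i = approximate i (≰⇒0<- ∑≰ε)

      I : Fin (size 𝒫) → Carrier
      I i = ∣ proj₁ (integral i (proj₁ (proj₂ (best i)))) ∣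

      ∑I : Carrier
      ∑I = sum I

      ∑≤ : ∑sup ≤ ∑I + η
      ∑≤ = begin
        sum (λ i → μ (p i) * sup i)
          ≤⟨ sum-mono-≤ (λ i → *-monoˡ-≤ (0≤μ (p i))
               (≤.trans (proj₂ (proj₂ (best i))) (+-mono-≤ (∣correlation∣≤ i (proj₁ (proj₂ (best i)))) ≤.refl))) ⟩
        sum (λ i → μ (p i) * (μ (p i) ⁻¹ * I i + η))
          ≈⟨ sum-cong (λ i → trans (distribˡ (μ (p i)) _ η) (+-congʳ (μ*μ⁻¹* (p i) (positive 𝒫 i) (I i)))) ⟩
        sum (λ i → I i + μ (p i) * η)
          ≈⟨ ∑-distrib-+ I (λ i → μ (p i) * η) ⟩
        ∑I + sum (λ i → μ (p i) * η)
          ≈⟨ +-congˡ (*-distribʳ-sum η (λ i → μ (p i))) ⟨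
        ∑I + sum (λ i → μ (p i)) * η
          ≈⟨ +-congˡ (trans (*-congʳ ∑μ≈1) (*-identityˡ η)) ⟩
        ∑I + η
          ∎

    increment : ∀ {ε} → 0# ≤ ε → (w : Witnesses S 𝓕 𝒫) →
      ε ≤ ∑∣integral∣ w →
      ∀ 𝒬 → _Refines_ S 𝒬 𝒫 →
      (∀ i j (Q⊆P : part 𝒬 j ⊆ part 𝒫 i) {x y} (x∈Q : x ∈ part 𝒬 j) (y∈Q : y ∈ part 𝒬 j) →
        _⟪_⟫ S (proj₁ (w i)) (Q⊆P x∈Q) CR.≈ _⟪_⟫ S (proj₁ (w i)) (Q⊆P y∈Q)) →
      energy 𝒫 + ε * ε ≤ energy 𝒬
    increment 0≤ε w ε≤ 𝒬 refines constant-on = energy-increases 0≤ε (≤.trans ε≤ (sum-mono-≤ λ i →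
      ∣integral-centred∣≤ i (proj₁ (w i)) (W.norm≤1 i (proj₂ (w i))) (constant-on i)
      {proj₁ (integral i (proj₂ (w i)))} (proj₂ (integral i (proj₂ (w i))))))
      where open Refinement 𝒫 𝒬 refines

-- The iteration and its bound.

lowerEM : ∀ {ℓ} → ExcludedMiddle (Level.suc ℓ) → ExcludedMiddle ℓ
lowerEM {ℓ} em {A} with em {Lift (Level.suc ℓ) A}
... | yes a = yes (lower a)
... | no ¬a = no (¬a ∘ lift)

theorem2p1 : ∀ {ℓ p} → ExcludedMiddle (Level.suc ℓ) →
    (R : CompleteOrderedField ℓ) (S : MeasureSpace R) →
    let open CompleteOrderedField R
        open MeasureSpace S using (X) in
    (𝓕 : Families S) →
    (∀ (𝒫 : Partition S) i → IsWitnessFamily S (Partition.part 𝒫 i) (𝓕 (Partition.part 𝒫 i))) →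
    (Part : ℕ → Pred (Partition S) p) →
    (∀ {M 𝒫} → 𝒫 ∈ Part M → Partition.size 𝒫 ℕ.≤ M) →
    (scheme : RefinementScheme S 𝓕 Part) →
    let open RefinementScheme scheme using (Φ) in
    (g : X → Carrier) → (∀ x → 0# ≤ g x × g x ≤ 1#) →
    BoundedMeasurable S (restrict S g U) →
    (ε : Carrier) → 0# < ε →
    (M₀ : ℕ) → NonZero M₀ → (𝒫₀ : Partition S) → 𝒫₀ ∈ Part M₀ →
    ∃[ N ] IsCeiling (ε ⁻¹ * ε ⁻¹) N ×
    (∃[ t ] t ℕ.≤ N × (∃[ 𝒫 ] 𝒫 ∈ Part (fold M₀ Φ t) × IsRegular S 𝓕 g ε 𝒫))
theorem2p1 {ℓ} em R S 𝓕 𝓕-witness Part size≤ scheme g 0≤g≤1 g-bm ε 0<ε M₀ _ 𝒫₀ 𝒫₀∈Part =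
  -- `search (suc N)` tests the N + 1 stages t = 0, ..., N. After N failures the energy is only
  -- known to be at least Nε² ≥ 1, which is consistent with the upper bound 1; the extra failure
  -- makes it exceed 1 by ε².
  N , proj₂ (ceiling (ε ⁻¹ * ε ⁻¹)) , conclude (search (suc N))
  where
  em′ : ExcludedMiddle ℓ
  em′ = lowerEM em

  open CompleteOrderedField R hiding (sum; zero)
  open MeasureSpace S using (μ)
  open RealProperties em′ R
  open Regularity em′ R S g 0≤g≤1 g-bm
  open RefinementScheme scheme
  open PosetReasoning poset

  N : ℕ
  N = proj₁ (ceiling (ε ⁻¹ * ε ⁻¹))

  RegularAt : ℕ → Set _
  RegularAt t = ∃[ 𝒫 ] 𝒫 ∈ Part (fold M₀ Φ t) × IsRegular S 𝓕 g ε 𝒫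

  HighEnergyAt : ℕ → Set _
  HighEnergyAt t = ∃[ 𝒫 ] 𝒫 ∈ Part (fold M₀ Φ t) × fromℕ t * (ε * ε) ≤ energy 𝒫

  -- Each failed test adds ε² to the energy and one application of Φ to the bound on parts:
  -- `fold M₀ Φ (suc n)` reduces to `Φ (fold M₀ Φ n)`, the index that `ψ-Part` delivers.
  search : ∀ n → (∃[ t ] t ℕ.< n × RegularAt t) ⊎ HighEnergyAt n
  search zero = inj₂ (𝒫₀ , 𝒫₀∈Part , ≤.trans (≤.reflexive (zeroˡ (ε * ε))) (0≤energy 𝒫₀))
  search (suc n) with search n
  ... | inj₁ (t , t<n , regular) = inj₁ (t , ℕ.m≤n⇒m≤1+n t<n , regular)
  ... | inj₂ (𝒫 , 𝒫∈Part , nε²≤energy) with sum (λ i → μ (Partition.measurable 𝒫 i) * Dichotomy.sup 𝓕 𝓕-witness 𝒫 i) ≤? ε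
  ...   | yes ∑≤ε = inj₁ (n , ℕ.≤-refl , 𝒫 , 𝒫∈Part , Dichotomy.regular 𝓕 𝓕-witness 𝒫 ∑≤ε)
  ...   | no  ∑≰ε = inj₂ (ψ 𝒫 admissible w , ψ-Part admissible w nonZero 𝒫∈Part , (begin
    (1# + fromℕ n) * (ε * ε)
      ≈⟨ solve 2 (λ n e → (con (+ 1) :+ n) :* e := n :* e :+ e) refl (fromℕ n) (ε * ε) ⟩
    fromℕ n * (ε * ε) + ε * ε
      ≤⟨ +-mono-≤ nε²≤energy ≤.refl ⟩
    energy 𝒫 + ε * ε
      ≤⟨ increment (proj₁ 0<ε) w (proj₂ (correlated ∑≰ε)) (ψ 𝒫 admissible w)
           (ψ-refines admissible w) (ψ-constant admissible w) ⟩
    energy (ψ 𝒫 admissible w)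
      ∎))
    where
    open Dichotomy 𝓕 𝓕-witness 𝒫 using (increment; correlated)

    w : Witnesses S 𝓕 𝒫
    w = proj₁ (correlated ∑≰ε)

    -- Φ is an arbitrary function and might take the value 0. Here it did not: 𝒫 has at least one
    -- part and at most `fold M₀ Φ n` parts.
    nonZero : NonZero (fold M₀ Φ n)
    nonZero = ℕ.>-nonZero (ℕ.<-≤-trans (0<size 𝒫) (size≤ 𝒫∈Part))

    admissible : 𝒫 ∈ Admissible S Part
    admissible = fold M₀ Φ n , nonZero , 𝒫∈Part

  ε⁻²*ε²≈1 : ε ⁻¹ * ε ⁻¹ * (ε * ε) ≈ 1#
  ε⁻²*ε²≈1 = begin-equality
    ε ⁻¹ * ε ⁻¹ * (ε * ε)    ≈⟨ solve 2 (λ i e → i :* i :* (e :* e) := e :* i :* (e :* i)) refl (ε ⁻¹) ε ⟩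
    ε * ε ⁻¹ * (ε * ε ⁻¹)    ≈⟨ *-cong (0<x⇒x*x⁻¹≈1 0<ε) (0<x⇒x*x⁻¹≈1 0<ε) ⟩
    1# * 1#                  ≈⟨ *-identityˡ 1# ⟩
    1#                       ∎

  ¬high : ¬ HighEnergyAt (suc N)
  ¬high (𝒫 , _ , high) = proj₂ 0<ε (sym (x*x≈0⇒x≈0 (≤.antisym (x+y≤x⇒y≤0 1+ε²≤1) (x*x-nonneg ε))))
    where
    1+ε²≤1 : 1# + ε * ε ≤ 1#
    1+ε²≤1 = begin
      1# + ε * ε                           ≈⟨ +-congʳ ε⁻²*ε²≈1 ⟨
      ε ⁻¹ * ε ⁻¹ * (ε * ε) + ε * ε        ≤⟨ +-mono-≤ (*-monoʳ-≤ (x*x-nonneg ε) (proj₁ (proj₂ (ceiling (ε ⁻¹ * ε ⁻¹))))) ≤.refl ⟩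
      fromℕ N * (ε * ε) + ε * ε            ≈⟨ solve 2 (λ n e → (con (+ 1) :+ n) :* e := n :* e :+ e) refl (fromℕ N) (ε * ε) ⟨
      (1# + fromℕ N) * (ε * ε)             ≤⟨ high ⟩
      energy 𝒫                             ≤⟨ energy≤1 𝒫 ⟩
      1#                                   ∎

  conclude : (∃[ t ] t ℕ.< suc N × RegularAt t) ⊎ HighEnergyAt (suc N) → ∃[ t ] t ℕ.≤ N × RegularAt t
  conclude (inj₁ (t , ℕ.s≤s t≤N , regular)) = t , t≤N , regular
  conclude (inj₂ high)                      = contradiction high ¬high
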